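{- For every fixed integer $r\ge 3$, almost all $r$-regular graphs have conflict-free connection number $2$; that is, the number of $r$-regular graphs on $n$ labeled vertices $G$ with $cfc(G)=2$, divided by the number of all $r$-regular graphs on these $n$ labeled vertices, tends to $1$ as $n\to\infty$.
   Context: For a connected graph $G$ with an edge-coloring (adjacent edges may share colors), a path is conflict-free if some color appears on exactly one of its edges; the coloring is a conflict-free connection coloring if every two distinct vertices are joined by a conflict-free path. The conflict-free connection number $cfc(G)$ is the minimum number of colors in such a coloring. -}

module Defs where

open import Data.Nat using (ℕ; zero; suc; _+_; _≡ᵇ_)
open import Data.Bool using (Bool; true; false; _∧_; not; T)
open import Data.Fin using (Fin; _≟_)
open import Data.Vec using (Vec; []; _∷_; lookup)
open import Data.List using (List; []; _∷_; length; filter; filterᵇ; concatMap; map; allFin)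
open import Data.List.Relation.Unary.Unique.Propositional using (Unique)
open import Data.Product using (Σ; ∃; _×_; _,_)
open import Relation.Binary.PropositionalEquality using (_≡_; _≢_)
open import Relation.Nullary using (¬_; Dec)

Adj : ℕ → Set
Adj n = Vec (Vec Bool n) n

adj : ∀ {n} → Adj n → Fin n → Fin n → Bool
adj M u v = lookup (lookup M u) v

allB : ∀ {n} → (Fin n → Bool) → Bool
allB {n} p = Data.List.foldr (λ i b → p i ∧ b) true (allFin n)

isSimple : ∀ {n} → Adj n → Bool
isSimple {n} M =
  allB (λ u → not (adj M u u) ∧ allB (λ v → eqB (adj M u v) (adj M v u)))
  where
  eqB : Bool → Bool → Bool
  eqB true true = true
  eqB false false = true
  eqB _ _ = false

degree : ∀ {n} → Adj n → Fin n → ℕ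
degree {n} M u = length (filterᵇ (adj M u) (allFin n))

isRegular : ∀ {n} → ℕ → Adj n → Bool
isRegular r M = allB (λ u → degree M u ≡ᵇ r)

allVecs : ∀ {A : Set} (m : ℕ) → List A → List (Vec A m)
allVecs zero xs = [] ∷ []
allVecs (suc m) xs = concatMap (λ x → map (x ∷_) (allVecs m xs)) xs

allAdj : (n : ℕ) → List (Adj n)
allAdj n = allVecs n (allVecs n (true ∷ false ∷ []))

regularGraphs : (r n : ℕ) → List (Adj n)
regularGraphs r n = filterᵇ (λ M → isSimple M ∧ isRegular r M) (allAdj n)

data Walk {n} (M : Adj n) : Fin n → Fin n → Set where
  []  : ∀ {u} → Walk M u u
  _∷_ : ∀ {u w v} → T (adj M u w) → Walk M w v → Walk M u v

vertices : ∀ {n} {M : Adj n} {u v} → Walk M u v → List (Fin n)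
vertices {u = u} [] = u ∷ []
vertices {u = u} (e ∷ p) = u ∷ vertices p

IsPath : ∀ {n} {M : Adj n} {u v} → Walk M u v → Set
IsPath p = Unique (vertices p)

-- an edge-coloring with k colors (only values on edges matter;
-- symmetric so that each edge gets a single color)
record Coloring {n} (M : Adj n) (k : ℕ) : Set where
  field
    col : Fin n → Fin n → Fin k
    sym : ∀ u v → col u v ≡ col v u
open Coloring public

edgeColors : ∀ {n} {M : Adj n} {k} → Coloring M k → ∀ {u v} → Walk M u v → List (Fin k)
edgeColors c [] = []
edgeColors c {u = u} (_∷_ {w = w} e p) = col c u w ∷ edgeColors c p

ConflictFree : ∀ {n} {M : Adj n} {k} → Coloring M k → ∀ {u v} → Walk M u v → Set
ConflictFree {k = k} c p =
  ∃ λ (a : Fin k) → length (filter (a ≟_) (edgeColors c p)) ≡ 1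

Connected : ∀ {n} → Adj n → Set
Connected {n} M = ∀ (u v : Fin n) → Σ (Walk M u v) IsPath

IsCFCColoring : ∀ {n} {M : Adj n} {k} → Coloring M k → Set
IsCFCColoring {n} {M} c =
  ∀ (u v : Fin n) → u ≢ v → ∃ λ (p : Walk M u v) → IsPath p × ConflictFree c p

HasCFC : ∀ {n} → Adj n → ℕ → Set
HasCFC M k = ∃ λ (c : Coloring M k) → IsCFCColoring c

CFC≡2 : ∀ {n} → Adj n → Set
CFC≡2 M = Connected M × HasCFC M 2 × ¬ HasCFC M 1

-- number of r-regular graphs on Fin n with cfc = 2, computed with any
-- decision procedure for CFC≡2 (the count does not depend on it)
countCFC2 : (dec : ∀ {n} (M : Adj n) → Dec (CFC≡2 M)) → (r n : ℕ) → ℕ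
countCFC2 dec r n = length (filter dec (regularGraphs r n))

countRegular : (r n : ℕ) → ℕ
countRegular r n = length (regularGraphs r n)

{-# OPTIONS --safe #-}
module Submission where

-- Call a nonempty set S of at most half of the vertices a sparse cut if at most r/2 edges leave it.
--
-- If G has no sparse cut, then no vertex w separates G: the edges leaving the parts of G - w all end in w,
-- so two parts with more than r/2 such edges each would exceed its degree r.  Colour a single edge xy
-- differently from all others.  As G has no cut vertex, any two vertices are joined by a path through xy,
-- and that path is conflict-free.
--
-- Sparse cuts are rare.  Fix S with |S| = s and let N(c) be the number of r-regular graphs in which exactly c
-- edges leave S.  Replacing an edge ab inside S and an edge xy outside S by ax and by gives
--   N(c) ((rs - c)(r(n - s) - c) - 2r²c) ≤ N(c + 2)(c + 2)².
-- Iterating from c = d bounds N(d) C(a , t) C(b , t) by the number R of all r-regular graphs up to a factor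
-- polynomial in t, for every t ≤ a, where a and b are slightly below rs/2 and r(n - s)/2.  Summing over t,
-- Vandermonde's identity gives N(d) C(a + b , a) ≤ poly · R, and C(a + b , a) exceeds the number C(n , s) of
-- sets of size s by a large enough factor for a union bound over S and d.

open import Defs hiding (sym)
open import Data.Nat
open import Data.Nat.Properties
open import Data.Nat.Combinatorics using (_C_; nCk+nC[k+1]≡[n+1]C[k+1]; k>n⇒nCk≡0; nCn≡1; nC1≡n; nCk≡nC[n∸k])
open import Data.Nat.Tactic.RingSolver using (solve-∀)
open import Data.Bool using (Bool; true; false; if_then_else_; _∧_; not; T)
open import Data.Bool.Properties using (T-≡; not-involutive; ∧-conicalˡ; ∧-conicalʳ; ¬-not) renaming (_≟_ to _≟ᵇ_)
open import Data.Fin using (Fin; zero; suc; fromℕ<) renaming (_≟_ to _≟ᶠ_)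
open import Data.Fin.Properties using (any?)
open import Data.Vec as Vec using (Vec; []; _∷_; lookup; updateAt)
open import Data.Vec.Properties using (lookup∘updateAt; lookup∘updateAt′; lookup∘tabulate; lookup-map)
open import Data.List using (List; []; _∷_; _++_; map; concatMap; allFin; length; filter; filterᵇ; upTo; foldr)
open import Data.List.Properties using (map-tabulate; length-tabulate; length-upTo; map-applyUpTo; filter-++; filter-all; filter-accept; filter-reject)
open import Data.List.Membership.Propositional using (_∈_)
open import Data.List.Membership.Propositional.Properties using (∈-allFin)
import Data.List.Membership.DecPropositional as DecMembership
open import Data.List.Relation.Unary.Any using (here; there)
open import Data.List.Relation.Unary.All as All using (All; []; _∷_; universal)
open import Data.List.Relation.Unary.All.Properties using (¬Any⇒All¬)
open import Data.List.Relation.Unary.AllPairs using ([]; _∷_)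
open import Data.List.Relation.Unary.Unique.Propositional using (Unique)
open import Data.List.Relation.Unary.Unique.Propositional.Properties using (++⁺)
open import Data.Product using (Σ; ∃; _×_; _,_; proj₁; proj₂)
open import Data.Sum using (_⊎_; inj₁; inj₂; swap)
open import Data.Empty using (⊥; ⊥-elim)
open import Relation.Nullary using (¬_; Dec; yes; no; does; contradiction)
open import Relation.Nullary.Decidable using (_×-dec_; _⊎-dec_; does-⇔; dec-true)
open import Relation.Binary.PropositionalEquality
open import Function using (_∘_; id; case_of_; Equivalence; mk⇔)

-- The limit is stated without division: for every `k`, eventually `k` times the number of
-- exceptional graphs is at most the number of all. The union bound makes the exceptional fraction
-- of order 1/n. The loss term `2r²c` obstructs a clean telescoping product. It is absorbed by
-- taking `a` and `b` below their natural values. As r ≥ 3, rs/2 exceeds s by at least s/2, which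
-- has to hold both the gain `p` and a slack `L`. How much fits depends on the size of S: nonempty
-- sets of fewer than four vertices may have no room but are never sparse; bounded sets afford one
-- power of n, enough for boundedly many sizes; large sets afford any fixed power. On the graph
-- side, a path through xy usually comes from Menger's theorem. Here two disjoint paths are replaced
-- by two disjoint vertex sets, which can be revised while one endpoint moves along a walk.
-- Reachability is never decided: case distinctions run under double negation, which is harmless
-- because positivity of the number of sparse cuts is decidable.

private variable
  X Y : Set
  n : ℕ

-- Finite sums

∑ : List X → (X → ℕ) → ℕ
∑ []       f = 0
∑ (x ∷ xs) f = f x + ∑ xs f

∑-mono : (xs : List X) {f g : X → ℕ} → (∀ x → f x ≤ g x) → ∑ xs f ≤ ∑ xs g
∑-mono []       h = z≤n
∑-mono (x ∷ xs) h = +-mono-≤ (h x) (∑-mono xs h)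

∑-cong : (xs : List X) {f g : X → ℕ} → (∀ x → f x ≡ g x) → ∑ xs f ≡ ∑ xs g
∑-cong []       h = refl
∑-cong (x ∷ xs) h = cong₂ _+_ (h x) (∑-cong xs h)

∑-+ : (xs : List X) (f g : X → ℕ) → ∑ xs (λ x → f x + g x) ≡ ∑ xs f + ∑ xs g
∑-+ []       f g = refl
∑-+ (x ∷ xs) f g = trans (cong (f x + g x +_) (∑-+ xs f g)) (lem (f x) (g x) (∑ xs f) (∑ xs g))
  where
  lem : ∀ a b c d → a + b + (c + d) ≡ a + c + (b + d)
  lem = solve-∀

∑-*ˡ : (xs : List X) (k : ℕ) (f : X → ℕ) → ∑ xs (λ x → k * f x) ≡ k * ∑ xs f
∑-*ˡ []       k f = sym (*-zeroʳ k)
∑-*ˡ (x ∷ xs) k f = trans (cong (k * f x +_) (∑-*ˡ xs k f)) (sym (*-distribˡ-+ k (f x) (∑ xs f)))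

∑-*ʳ : (xs : List X) (k : ℕ) (f : X → ℕ) → ∑ xs (λ x → f x * k) ≡ ∑ xs f * k
∑-*ʳ xs k f = trans (∑-cong xs (λ x → *-comm (f x) k)) (trans (∑-*ˡ xs k f) (*-comm k (∑ xs f)))

∑-zero : (xs : List X) → ∑ xs (λ _ → 0) ≡ 0
∑-zero []       = refl
∑-zero (x ∷ xs) = ∑-zero xs

∑-const : (xs : List X) (k : ℕ) → ∑ xs (λ _ → k) ≡ length xs * k
∑-const []       k = refl
∑-const (x ∷ xs) k = cong (k +_) (∑-const xs k)

∑-swap : (xs : List X) (ys : List Y) (f : X → Y → ℕ) →
  ∑ xs (λ x → ∑ ys (f x)) ≡ ∑ ys (λ y → ∑ xs (λ x → f x y))
∑-swap []       ys f = sym (∑-zero ys)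
∑-swap (x ∷ xs) ys f = trans (cong (∑ ys (f x) +_) (∑-swap xs ys f)) (sym (∑-+ ys _ _))

∑-++ : (xs ys : List X) (f : X → ℕ) → ∑ (xs ++ ys) f ≡ ∑ xs f + ∑ ys f
∑-++ []       ys f = refl
∑-++ (x ∷ xs) ys f = trans (cong (f x +_) (∑-++ xs ys f)) (sym (+-assoc (f x) _ _))

∑-map : (g : X → Y) (xs : List X) (f : Y → ℕ) → ∑ (map g xs) f ≡ ∑ xs (f ∘ g)
∑-map g []       f = refl
∑-map g (x ∷ xs) f = cong (f (g x) +_) (∑-map g xs f)

∑-concatMap : (g : X → List Y) (xs : List X) (f : Y → ℕ) →
  ∑ (concatMap g xs) f ≡ ∑ xs (λ x → ∑ (g x) f)
∑-concatMap g []       f = refl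
∑-concatMap g (x ∷ xs) f = trans (∑-++ (g x) _ f) (cong (∑ (g x) f +_) (∑-concatMap g xs f))

⟦_⟧ : Bool → ℕ
⟦ b ⟧ = if b then 1 else 0

⟦∧⟧ : ∀ b c → ⟦ b ∧ c ⟧ ≡ ⟦ b ⟧ * ⟦ c ⟧
⟦∧⟧ true  c = sym (+-identityʳ ⟦ c ⟧)
⟦∧⟧ false c = refl

length-filterᵇ : (p : X → Bool) (xs : List X) → length (filterᵇ p xs) ≡ ∑ xs (⟦_⟧ ∘ p)
length-filterᵇ p []       = refl
length-filterᵇ p (x ∷ xs) with p x
... | true  = cong suc (length-filterᵇ p xs)
... | false = length-filterᵇ p xs

∑F : ∀ {n} → (Fin n → ℕ) → ℕ
∑F {n} = ∑ (allFin n)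

∑F-suc : ∀ {n} (f : Fin (suc n) → ℕ) → ∑F f ≡ f zero + ∑F (f ∘ suc)
∑F-suc {n} f = cong (f zero +_)
  (trans (cong (λ l → ∑ l f) (sym (map-tabulate id suc))) (∑-map suc (allFin n) f))

∑F-term : ∀ {n} (f : Fin n → ℕ) i → f i ≤ ∑F f
∑F-term {suc n} f i = ≤-trans (lem i) (≤-reflexive (sym (∑F-suc f)))
  where
  lem : ∀ i → f i ≤ f zero + ∑F (f ∘ suc)
  lem zero    = m≤m+n _ _
  lem (suc i) = ≤-trans (∑F-term (f ∘ suc) i) (m≤n+m _ _)

∑F-const : ∀ n k → ∑F {n} (λ _ → k) ≡ n * k
∑F-const n k = trans (∑-const (allFin n) k) (cong (_* k) {length (allFin n)} {n} (length-tabulate id))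

[_≐_] : ∀ {n} → Fin n → Fin n → ℕ
[ i ≐ j ] = ⟦ does (i ≟ᶠ j) ⟧

≐-refl : ∀ {n} (i : Fin n) → [ i ≐ i ] ≡ 1
≐-refl i with i ≟ᶠ i
... | yes _  = refl
... | no i≢i = contradiction refl i≢i

≐-≢ : ∀ {n} {i j : Fin n} → i ≢ j → [ i ≐ j ] ≡ 0
≐-≢ {i = i} {j} i≢j with i ≟ᶠ j
... | yes i≡j = contradiction i≡j i≢j
... | no _    = refl

∑F-≐ : ∀ {n} (i : Fin n) (f : Fin n → ℕ) → ∑F (λ j → [ i ≐ j ] * f j) ≡ f i
∑F-≐ {suc n} zero f = begin
  ∑F (λ j → [ zero ≐ j ] * f j)   ≡⟨ ∑F-suc (λ j → [ zero ≐ j ] * f j) ⟩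
  f zero + 0 + ∑F {n} (λ _ → 0)   ≡⟨ cong₂ _+_ (+-identityʳ (f zero)) (∑-zero (allFin n)) ⟩
  f zero + 0                      ≡⟨ +-identityʳ (f zero) ⟩
  f zero                          ∎
  where open ≡-Reasoning
∑F-≐ {suc n} (suc i) f = trans (∑F-suc (λ j → [ suc i ≐ j ] * f j)) (trans (∑-cong (allFin n) (λ j → cong (_* f (suc j)) (lem j))) (∑F-≐ i (f ∘ suc)))
  where
  lem : ∀ j → [ suc i ≐ suc j ] ≡ [ i ≐ j ]
  lem j with i ≟ᶠ j
  ... | yes _ = refl
  ... | no  _ = refl

∑<-suc : ∀ n (f : ℕ → ℕ) → ∑ (upTo (suc n)) f ≡ f 0 + ∑ (upTo n) (f ∘ suc)
∑<-suc n f = cong (f 0 +_)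
  (trans (cong (λ l → ∑ l f) (sym (map-applyUpTo id suc n))) (∑-map suc (upTo n) f))

∑<-mono : ∀ n {f g : ℕ → ℕ} → (∀ i → i < n → f i ≤ g i) → ∑ (upTo n) f ≤ ∑ (upTo n) g
∑<-mono zero    h = z≤n
∑<-mono (suc n) {f} {g} h = begin
  ∑ (upTo (suc n)) f         ≡⟨ ∑<-suc n f ⟩
  f 0 + ∑ (upTo n) (f ∘ suc) ≤⟨ +-mono-≤ (h 0 z<s) (∑<-mono n (λ i i<n → h (suc i) (s<s i<n))) ⟩
  g 0 + ∑ (upTo n) (g ∘ suc) ≡⟨ ∑<-suc n g ⟨
  ∑ (upTo (suc n)) g         ∎
  where open ≤-Reasoning

∑<-term : ∀ n (f : ℕ → ℕ) {i} → i < n → f i ≤ ∑ (upTo n) f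
∑<-term (suc n) f {i} i<n = ≤-trans (lem i i<n) (≤-reflexive (sym (∑<-suc n f)))
  where
  lem : ∀ i → i < suc n → f i ≤ f 0 + ∑ (upTo n) (f ∘ suc)
  lem zero    _ = m≤m+n _ _
  lem (suc i) h = ≤-trans (∑<-term n (f ∘ suc) (s<s⁻¹ h)) (m≤n+m _ _)

∑<-const : ∀ n k → ∑ (upTo n) (λ _ → k) ≡ n * k
∑<-const n k = trans (∑-const (upTo n) k) (cong (_* k) {length (upTo n)} {n} (length-upTo n))

∑² : (Fin n → Fin n → ℕ) → ℕ
∑² f = ∑F λ u → ∑F λ v → f u v

∑⁴ : (Fin n → Fin n → Fin n → Fin n → ℕ) → ℕ
∑⁴ f = ∑² λ a b → ∑² λ x y → f a b x y

∑²-cong : {f g : Fin n → Fin n → ℕ} → (∀ u v → f u v ≡ g u v) → ∑² f ≡ ∑² g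
∑²-cong h = ∑-cong (allFin _) (λ u → ∑-cong (allFin _) (h u))

∑²-mono : {f g : Fin n → Fin n → ℕ} → (∀ u v → f u v ≤ g u v) → ∑² f ≤ ∑² g
∑²-mono h = ∑-mono (allFin _) (λ u → ∑-mono (allFin _) (h u))

∑²-+ : (f g : Fin n → Fin n → ℕ) → ∑² (λ u v → f u v + g u v) ≡ ∑² f + ∑² g
∑²-+ {n} f g = trans (∑-cong (allFin n) (λ u → ∑-+ (allFin n) (f u) (g u))) (∑-+ (allFin n) _ _)

∑²-*ˡ : ∀ k (f : Fin n → Fin n → ℕ) → ∑² (λ u v → k * f u v) ≡ k * ∑² f
∑²-*ˡ {n} k f = trans (∑-cong (allFin n) (λ u → ∑-*ˡ (allFin n) k (f u))) (∑-*ˡ (allFin n) k _)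

∑²-*ʳ : ∀ k (f : Fin n → Fin n → ℕ) → ∑² (λ u v → f u v * k) ≡ ∑² f * k
∑²-*ʳ {n} k f = trans (∑-cong (allFin n) (λ u → ∑-*ʳ (allFin n) k (f u))) (∑-*ʳ (allFin n) k _)

∑²-swap : (f : Fin n → Fin n → ℕ) → ∑² f ≡ ∑² (λ u v → f v u)
∑²-swap {n} f = ∑-swap (allFin n) (allFin n) f

∑²-* : (f g : Fin n → Fin n → ℕ) → ∑² f * ∑² g ≡ ∑⁴ (λ a b x y → f a b * g x y)
∑²-* f g = trans (sym (∑²-*ʳ (∑² g) f)) (∑²-cong (λ a b → sym (∑²-*ˡ (f a b) g)))

∑F-* : (f g : Fin n → ℕ) → ∑F f * ∑F g ≡ ∑² (λ u v → f u * g v)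
∑F-* {n} f g = trans (sym (∑-*ʳ (allFin n) (∑F g) f)) (∑-cong (allFin n) (λ u → sym (∑-*ˡ (allFin n) (f u) g)))

∑-∑²-swap : (xs : List X) (f : X → Fin n → Fin n → ℕ) →
  ∑ xs (λ x → ∑² (f x)) ≡ ∑² (λ u v → ∑ xs (λ x → f x u v))
∑-∑²-swap {n = n} xs f = trans (∑-swap xs (allFin n) _) (∑-cong (allFin n) (λ u → ∑-swap xs (allFin n) _))

∑-∑⁴-swap : (xs : List X) (f : X → Fin n → Fin n → Fin n → Fin n → ℕ) →
  ∑ xs (λ x → ∑⁴ (f x)) ≡ ∑⁴ (λ a b c d → ∑ xs (λ x → f x a b c d))
∑-∑⁴-swap {n = n} xs f = trans (∑-∑²-swap {n = n} xs _) (∑²-cong {n} (λ a b → ∑-∑²-swap {n = n} xs (λ x → f x a b)))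

-- Binomial coefficients

nC0≡1 : ∀ n → n C 0 ≡ 1
nC0≡1 n = trans (nCk≡nC[n∸k] {0} {n} z≤n) (nCn≡1 n)

C-pascal : ∀ n k → suc n C suc k ≡ n C k + n C suc k
C-pascal n k = sym (nCk+nC[k+1]≡[n+1]C[k+1] n k)

C-absorb : ∀ n k → suc k * (n C suc k) ≡ (n C k) * (n ∸ k)
C-absorb zero    k = begin
  suc k * (0 C suc k) ≡⟨ cong (suc k *_) (k>n⇒nCk≡0 {0} {suc k} z<s) ⟩
  suc k * 0           ≡⟨ *-zeroʳ (suc k) ⟩
  0                   ≡⟨ *-zeroʳ (0 C k) ⟨
  (0 C k) * 0         ≡⟨ cong ((0 C k) *_) (0∸n≡0 k) ⟨
  (0 C k) * (0 ∸ k)   ∎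
  where open ≡-Reasoning
C-absorb (suc n) zero = begin
  1 * (suc n C 1)         ≡⟨ *-identityˡ _ ⟩
  suc n C 1               ≡⟨ nC1≡n (suc n) ⟩
  suc n                   ≡⟨ *-identityˡ _ ⟨
  1 * suc n               ≡⟨ cong (_* suc n) (nC0≡1 (suc n)) ⟨
  (suc n C 0) * suc n     ∎
  where open ≡-Reasoning
C-absorb (suc n) (suc k) = begin
  suc (suc k) * (suc n C suc (suc k))
    ≡⟨ cong (suc (suc k) *_) (C-pascal n (suc k)) ⟩
  suc (suc k) * (n C suc k + n C suc (suc k))
    ≡⟨ *-distribˡ-+ (suc (suc k)) (n C suc k) _ ⟩
  suc (suc k) * (n C suc k) + suc (suc k) * (n C suc (suc k))
    ≡⟨ cong (suc (suc k) * (n C suc k) +_) (C-absorb n (suc k)) ⟩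
  suc (suc k) * (n C suc k) + (n C suc k) * (n ∸ suc k)
    ≡⟨ lem₁ k (n C suc k) (n ∸ suc k) ⟩
  suc k * (n C suc k) + (n C suc k) * suc (n ∸ suc k)
    ≡⟨ cong₂ _+_ (C-absorb n k) shift ⟩
  (n C k) * (n ∸ k) + (n C suc k) * (n ∸ k)
    ≡⟨ *-distribʳ-+ (n ∸ k) (n C k) (n C suc k) ⟨
  (n C k + n C suc k) * (n ∸ k)
    ≡⟨ cong (_* (n ∸ k)) (C-pascal n k) ⟨
  (suc n C suc k) * (n ∸ k) ∎
  where
  open ≡-Reasoning
  lem₁ : ∀ k c m → suc (suc k) * c + c * m ≡ suc k * c + c * suc m
  lem₁ = solve-∀
  -- For `k ≥ n` the truncated differences give `1` against `0`, but the binomial in front vanishes.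
  shift : (n C suc k) * suc (n ∸ suc k) ≡ (n C suc k) * (n ∸ k)
  shift with suc k ≤? n
  ... | yes k<n = cong ((n C suc k) *_) (sym (+-∸-assoc 1 k<n))
  ... | no k≮n rewrite k>n⇒nCk≡0 {n} {suc k} (≰⇒> k≮n) = refl

vandermonde : ∀ a b k → (a + b) C k ≡ ∑ (upTo (suc k)) (λ i → (a C i) * (b C (k ∸ i)))
vandermonde zero b k = sym (begin
  ∑ (upTo (suc k)) (λ i → (0 C i) * (b C (k ∸ i)))
    ≡⟨ ∑<-suc k _ ⟩
  1 * (b C k) + ∑ (upTo k) (λ i → (0 C suc i) * (b C (k ∸ suc i)))
    ≡⟨ cong₂ _+_ (*-identityˡ (b C k)) (trans (∑-cong (upTo k) (λ i → cong (_* (b C (k ∸ suc i))) (k>n⇒nCk≡0 {0} {suc i} z<s))) (∑-zero (upTo k))) ⟩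
  b C k + 0
    ≡⟨ +-identityʳ _ ⟩
  b C k ∎)
  where open ≡-Reasoning
vandermonde (suc a) b zero = begin
  suc (a + b) C 0          ≡⟨ nC0≡1 (suc (a + b)) ⟩
  1                        ≡⟨ cong₂ _*_ (nC0≡1 (suc a)) (nC0≡1 b) ⟨
  (suc a C 0) * (b C 0)    ≡⟨ +-identityʳ _ ⟨
  (suc a C 0) * (b C 0) + 0 ∎
  where open ≡-Reasoning
vandermonde (suc a) b (suc k) = begin
  suc (a + b) C suc k
    ≡⟨ C-pascal (a + b) k ⟩
  (a + b) C k + (a + b) C suc k
    ≡⟨ cong₂ _+_ (vandermonde a b k) (trans (vandermonde a b (suc k)) (∑<-suc (suc k) (λ i → (a C i) * (b C (suc k ∸ i))))) ⟩
  ∑ (upTo (suc k)) f + ((a C 0) * (b C suc k) + ∑ (upTo (suc k)) g)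
    ≡⟨ lem (∑ (upTo (suc k)) f) ((a C 0) * (b C suc k)) (∑ (upTo (suc k)) g) ⟩
  (a C 0) * (b C suc k) + (∑ (upTo (suc k)) f + ∑ (upTo (suc k)) g)
    ≡⟨ cong₂ _+_ (cong (_* (b C suc k)) (trans (nC0≡1 a) (sym (nC0≡1 (suc a)))))
        (trans (sym (∑-+ (upTo (suc k)) f g)) (∑-cong (upTo (suc k)) (λ i →
          trans (sym (*-distribʳ-+ (b C (k ∸ i)) (a C i) (a C suc i)))
                (cong (_* (b C (k ∸ i))) (sym (C-pascal a i)))))) ⟩
  (suc a C 0) * (b C suc k) + ∑ (upTo (suc k)) (λ i → (suc a C suc i) * (b C (k ∸ i)))
    ≡⟨ ∑<-suc (suc k) (λ i → (suc a C i) * (b C (suc k ∸ i))) ⟨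
  ∑ (upTo (suc (suc k))) (λ i → (suc a C i) * (b C (suc k ∸ i))) ∎
  where
  open ≡-Reasoning
  f g : ℕ → ℕ
  f i = (a C i) * (b C (k ∸ i))
  g i = (a C suc i) * (b C (k ∸ i))
  lem : ∀ x y z → x + (y + z) ≡ y + (x + z)
  lem = solve-∀

-- The product is a single term of Vandermonde's sum.
C-*-≤ : ∀ m k m′ k′ → (m C k) * (m′ C k′) ≤ (m + m′) C (k + k′)
C-*-≤ m k m′ k′ = begin
  (m C k) * (m′ C k′)
    ≡⟨ cong (λ j → (m C k) * (m′ C j)) (m+n∸m≡n k k′) ⟨
  (m C k) * (m′ C (k + k′ ∸ k))
    ≤⟨ ∑<-term (suc (k + k′)) (λ i → (m C i) * (m′ C (k + k′ ∸ i))) (s≤s (m≤m+n k k′)) ⟩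
  ∑ (upTo (suc (k + k′))) (λ i → (m C i) * (m′ C (k + k′ ∸ i)))
    ≡⟨ vandermonde m m′ (k + k′) ⟨
  (m + m′) C (k + k′) ∎
  where open ≤-Reasoning

C-pos : ∀ {n k} → k ≤ n → 1 ≤ n C k
C-pos {n} {zero}  _ = ≤-reflexive (sym (nC0≡1 n))
C-pos {suc n} {suc k} h = ≤-trans (C-pos (s≤s⁻¹ h)) (≤-trans (m≤m+n _ _) (≤-reflexive (sym (C-pascal n k))))

-- Absorption along the diagonal: the factors `suc j + d` of the iterated switching inequality, each
-- divided by `suc j`, multiply up to `(t + d) C t`.
C-diag : ∀ m k → suc k * (suc (k + m) C suc k) ≡ suc (k + m) * ((k + m) C k)
C-diag m k = begin
  suc k * (suc (k + m) C suc k)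
    ≡⟨ cong (suc k *_) (C-pascal (k + m) k) ⟩
  suc k * ((k + m) C k + (k + m) C suc k)
    ≡⟨ *-distribˡ-+ (suc k) ((k + m) C k) _ ⟩
  suc k * ((k + m) C k) + suc k * ((k + m) C suc k)
    ≡⟨ cong (suc k * ((k + m) C k) +_) (C-absorb (k + m) k) ⟩
  suc k * ((k + m) C k) + ((k + m) C k) * (k + m ∸ k)
    ≡⟨ cong (λ z → suc k * ((k + m) C k) + ((k + m) C k) * z) (m+n∸m≡n k m) ⟩
  suc k * ((k + m) C k) + ((k + m) C k) * m
    ≡⟨ lem k m _ ⟩
  suc (k + m) * ((k + m) C k) ∎
  where
  open ≡-Reasoning
  lem : ∀ k m c → suc k * c + c * m ≡ suc (k + m) * c
  lem = solve-∀

-- The right side is the rising product (q + 1) ... (q + p), and each of its factors is at least q +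
-- 1. This turns a binomial gain into a power of n once q is proportional to n.
^≤!*C : ∀ p q → suc q ^ p ≤ p ! * ((p + q) C p)
^≤!*C zero    q = ≤-reflexive (sym (trans (+-identityʳ _) (nC0≡1 q)))
^≤!*C (suc p) q = begin
  suc q * suc q ^ p                    ≤⟨ *-mono-≤ (s≤s (m≤n+m q p)) (^≤!*C p q) ⟩
  suc (p + q) * (p ! * ((p + q) C p))  ≡⟨ lem (suc (p + q)) (p !) ((p + q) C p) ⟩
  p ! * (suc (p + q) * ((p + q) C p))  ≡⟨ cong (p ! *_) (C-diag q p) ⟨
  p ! * (suc p * (suc (p + q) C suc p)) ≡⟨ lem′ (p !) (suc p) _ ⟩
  suc p * p ! * (suc (p + q) C suc p)  ∎
  where
  open ≤-Reasoning
  lem : ∀ x y z → x * (y * z) ≡ y * (x * z)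
  lem = solve-∀
  lem′ : ∀ x y z → x * (y * z) ≡ y * x * z
  lem′ = solve-∀

-- The binomial is the product of (m + i) / i for i = 1, ..., d, each factor being at most m + 1;
-- for fixed `d` it is thus polynomial in `m`. Pascal's rule gives a proof without fractions.
C-≤-^ : ∀ m d → (m + d) C m ≤ suc m ^ d
C-≤-^ zero    d = ≤-trans (≤-reflexive (nC0≡1 d)) (≤-reflexive (sym (^-zeroˡ d)))
C-≤-^ (suc m) zero    = ≤-reflexive (trans (cong (_C suc m) (+-identityʳ (suc m))) (nCn≡1 (suc m)))
C-≤-^ (suc m) (suc d) = begin
  suc (m + suc d) C suc m
    ≡⟨ C-pascal (m + suc d) m ⟩
  (m + suc d) C m + (m + suc d) C suc m
    ≡⟨ cong (λ z → (m + suc d) C m + z C suc m) (+-suc m d) ⟩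
  (m + suc d) C m + (suc m + d) C suc m
    ≤⟨ +-mono-≤ (≤-trans (C-≤-^ m (suc d)) (≤-trans (*-monoʳ-≤ (suc m) (^-monoˡ-≤ d (n≤1+n (suc m)))) ≤-refl)) (C-≤-^ (suc m) d) ⟩
  suc m * (2 + m) ^ d + (2 + m) ^ d
    ≡⟨ +-comm (suc m * (2 + m) ^ d) _ ⟩
  (2 + m) ^ suc d ∎
  where open ≤-Reasoning

-- Flipping edges and switching

∑-allVecs-suc : ∀ m (xs : List X) (f : Vec X (suc m) → ℕ) →
  ∑ (allVecs (suc m) xs) f ≡ ∑ xs (λ x → ∑ (allVecs m xs) (f ∘ (x ∷_)))
∑-allVecs-suc m xs f = trans (∑-concatMap (λ x → map (x ∷_) (allVecs m xs)) xs f)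
  (∑-cong xs (λ x → ∑-map (x ∷_) (allVecs m xs) f))

-- A change of variables. That `φ` permutes `xs` is expressed through invariance of sums, so that
-- the conclusion for rows is the hypothesis needed for matrices.
∑-allVecs-updateAt : ∀ m (xs : List X) (φ : X → X) →
  (∀ g → ∑ xs (g ∘ φ) ≡ ∑ xs g) → ∀ i (f : Vec X m → ℕ) →
  ∑ (allVecs m xs) (λ v → f (updateAt v i φ)) ≡ ∑ (allVecs m xs) f
∑-allVecs-updateAt (suc m) xs φ inv zero f = begin
  ∑ (allVecs (suc m) xs) (λ v → f (updateAt v zero φ))
    ≡⟨ ∑-allVecs-suc m xs _ ⟩
  ∑ xs (λ x → ∑ (allVecs m xs) (λ v → f (φ x ∷ v)))
    ≡⟨ inv (λ x → ∑ (allVecs m xs) (λ v → f (x ∷ v))) ⟩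
  ∑ xs (λ x → ∑ (allVecs m xs) (λ v → f (x ∷ v)))
    ≡⟨ ∑-allVecs-suc m xs f ⟨
  ∑ (allVecs (suc m) xs) f ∎
  where open ≡-Reasoning
∑-allVecs-updateAt (suc m) xs φ inv (suc i) f = begin
  ∑ (allVecs (suc m) xs) (λ v → f (updateAt v (suc i) φ))
    ≡⟨ ∑-allVecs-suc m xs _ ⟩
  ∑ xs (λ x → ∑ (allVecs m xs) (λ v → f (x ∷ updateAt v i φ)))
    ≡⟨ ∑-cong xs (λ x → ∑-allVecs-updateAt m xs φ inv i (f ∘ (x ∷_))) ⟩
  ∑ xs (λ x → ∑ (allVecs m xs) (λ v → f (x ∷ v)))
    ≡⟨ ∑-allVecs-suc m xs f ⟨
  ∑ (allVecs (suc m) xs) f ∎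
  where open ≡-Reasoning

toggle : Fin n → Fin n → Adj n → Adj n
toggle i j M = updateAt M i (λ row → updateAt row j not)

∑-toggle : ∀ (i j : Fin n) (f : Adj n → ℕ) →
  ∑ (allAdj n) (f ∘ toggle i j) ≡ ∑ (allAdj n) f
∑-toggle {n} i j f =
  ∑-allVecs-updateAt n _ _ (∑-allVecs-updateAt n _ not lem j) i f
  where
  lem : ∀ (g : Bool → ℕ) → ∑ (true ∷ false ∷ []) (g ∘ not) ≡ ∑ (true ∷ false ∷ []) g
  lem g = l (g false) (g true)
    where
    l : ∀ a b → a + (b + 0) ≡ b + (a + 0)
    l = solve-∀

adj-toggle : ∀ (i j : Fin n) M → adj (toggle i j M) i j ≡ not (adj M i j)
adj-toggle i j M = trans (cong (λ row → lookup row j) (lookup∘updateAt i M))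
                         (lookup∘updateAt j (lookup M i))

adj-toggle-≢ : ∀ {i j u v : Fin n} M → u ≢ i ⊎ v ≢ j → adj (toggle i j M) u v ≡ adj M u v
adj-toggle-≢ {i = i} {j} {u} {v} M h with u ≟ᶠ i
... | no u≢i = cong (λ row → lookup row v) (lookup∘updateAt′ u i u≢i M)
... | yes refl with h
...   | inj₁ i≢i = contradiction refl i≢i
...   | inj₂ v≢j = trans (cong (λ row → lookup row v) (lookup∘updateAt i M))
                         (lookup∘updateAt′ v j v≢j (lookup M i))

-- Toggling, unlike setting an entry, is a bijection of all Boolean matrices, so sums over
-- `allAdj n` are reindexed with no condition on the matrix.
flipEdge : Fin n → Fin n → Adj n → Adj n
flipEdge i j = toggle i j ∘ toggle j i

∑-flipEdge : ∀ (i j : Fin n) (f : Adj n → ℕ) →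
  ∑ (allAdj n) (f ∘ flipEdge i j) ≡ ∑ (allAdj n) f
∑-flipEdge i j f = trans (∑-toggle j i (f ∘ toggle i j)) (∑-toggle i j f)

module _ {i j : Fin n} (M : Adj n) where

  flipEdge-≢ : ∀ {u v} → u ≢ i ⊎ v ≢ j → u ≢ j ⊎ v ≢ i → adj (flipEdge i j M) u v ≡ adj M u v
  flipEdge-≢ p q = trans (adj-toggle-≢ (toggle j i M) p) (adj-toggle-≢ M q)

  module _ (i≢j : i ≢ j) where

    flipEdge-ij : adj (flipEdge i j M) i j ≡ not (adj M i j)
    flipEdge-ij = trans (adj-toggle i j (toggle j i M)) (cong not (adj-toggle-≢ M (inj₁ i≢j)))

    flipEdge-ji : adj (flipEdge i j M) j i ≡ not (adj M j i)
    flipEdge-ji = trans (adj-toggle-≢ (toggle j i M) (inj₁ (i≢j ∘ sym))) (adj-toggle j i M)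

Symmetric Irreflexive : Adj n → Set
Symmetric M = ∀ u v → adj M u v ≡ adj M v u
Irreflexive M = ∀ u → adj M u u ≡ false

flipEdge-irreflexive : ∀ {i j : Fin n} {M} → i ≢ j → Irreflexive M → Irreflexive (flipEdge i j M)
flipEdge-irreflexive {i = i} {j} {M} i≢j irr u = trans (flipEdge-≢ M p q) (irr u)
  where
  p : u ≢ i ⊎ u ≢ j
  p with u ≟ᶠ i
  ... | yes refl = inj₂ i≢j
  ... | no u≢i = inj₁ u≢i
  q : u ≢ j ⊎ u ≢ i
  q with u ≟ᶠ i
  ... | yes refl = inj₁ i≢j
  ... | no u≢i = inj₂ u≢i

data Position (i j u v : Fin n) : Set where
  at-ij : u ≡ i → v ≡ j → Position i j u v
  at-ji : u ≡ j → v ≡ i → Position i j u v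
  away  : u ≢ i ⊎ v ≢ j → u ≢ j ⊎ v ≢ i → Position i j u v

position : ∀ (i j u v : Fin n) → Position i j u v
position i j u v with u ≟ᶠ i | v ≟ᶠ j | u ≟ᶠ j | v ≟ᶠ i
... | yes p | yes q | _     | _     = at-ij p q
... | _     | _     | yes p | yes q = at-ji p q
... | no p  | _     | no q  | _     = away (inj₁ p) (inj₁ q)
... | no p  | _     | _     | no q  = away (inj₁ p) (inj₂ q)
... | _     | no p  | no q  | _     = away (inj₂ p) (inj₁ q)
... | _     | no p  | _     | no q  = away (inj₂ p) (inj₂ q)

flipEdge-symmetric : ∀ {i j : Fin n} {M} → i ≢ j → Symmetric M → Symmetric (flipEdge i j M)
flipEdge-symmetric {i = i} {j} {M} i≢j s u v with position i j u v
... | at-ij refl refl = trans (flipEdge-ij M i≢j) (trans (cong not (s i j)) (sym (flipEdge-ji M i≢j)))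
... | at-ji refl refl = trans (flipEdge-ji M i≢j) (trans (cong not (s j i)) (sym (flipEdge-ij M i≢j)))
... | away p q = trans (flipEdge-≢ M p q) (trans (s u v) (sym (flipEdge-≢ M (swap q) (swap p))))

-- A linear functional of the matrix. Degrees and cut sizes are both instances, so the effect of a
-- switch on either follows from one computation.
weight : (Fin n → Fin n → ℕ) → Adj n → ℕ
weight W M = ∑F λ u → ∑F λ v → W u v * ⟦ adj M u v ⟧

private
  δ : (i j u v : Fin n) → ℕ
  δ i j u v = [ i ≐ u ] * [ j ≐ v ] + [ j ≐ u ] * [ i ≐ v ]

  ≐-miss : ∀ {i j u v : Fin n} → u ≢ i ⊎ v ≢ j → [ i ≐ u ] * [ j ≐ v ] ≡ 0
  ≐-miss {j = j} {v = v} (inj₁ p) = cong (_* [ j ≐ v ]) (≐-≢ (p ∘ sym))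
  ≐-miss {i = i} {u = u} (inj₂ p) = trans (cong ([ i ≐ u ] *_) (≐-≢ (p ∘ sym))) (*-zeroʳ [ i ≐ u ])

  -- Subtraction-free form of the change: `δ` marks the two entries of the edge, and it is added on
  -- the left if the edge was present and on the right if it was absent.
  flipEdge-⟦⟧ : ∀ {i j : Fin n} {M} → i ≢ j → Symmetric M → ∀ u v →
    ⟦ adj (flipEdge i j M) u v ⟧ + ⟦ adj M i j ⟧ * δ i j u v ≡
    ⟦ adj M u v ⟧ + ⟦ not (adj M i j) ⟧ * δ i j u v
  flipEdge-⟦⟧ {i = i} {j} {M} i≢j s u v with position i j u v
  ... | at-ij refl refl
      rewrite flipEdge-ij M i≢j | ≐-refl i | ≐-refl j | ≐-≢ i≢j | ≐-≢ (i≢j ∘ sym)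
      with adj M i j
  ...   | true = refl
  ...   | false = refl
  flipEdge-⟦⟧ {i = i} {j} {M} i≢j s u v | at-ji refl refl
      rewrite flipEdge-ji M i≢j | s j i | ≐-refl i | ≐-refl j | ≐-≢ i≢j
      with adj M i j
  ...   | true = refl
  ...   | false = refl
  flipEdge-⟦⟧ {i = i} {j} {M} i≢j s u v | away p q
      rewrite flipEdge-≢ M p q | ≐-miss p | ≐-miss q
        | *-zeroʳ ⟦ adj M i j ⟧ | *-zeroʳ ⟦ not (adj M i j) ⟧ = refl

  ∑F∑F-≐ : ∀ (i j : Fin n) (W : Fin n → Fin n → ℕ) →
    ∑F (λ u → ∑F (λ v → W u v * ([ i ≐ u ] * [ j ≐ v ]))) ≡ W i j
  ∑F∑F-≐ {n} i j W = begin
    ∑F (λ u → ∑F (λ v → W u v * ([ i ≐ u ] * [ j ≐ v ])))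
      ≡⟨ ∑-cong (allFin n) (λ u → trans
           (∑-cong (allFin n) (λ v → lem (W u v) [ i ≐ u ] [ j ≐ v ]))
           (trans (∑-*ˡ (allFin n) [ i ≐ u ] _) (cong ([ i ≐ u ] *_) (∑F-≐ j (W u))))) ⟩
    ∑F (λ u → [ i ≐ u ] * W u j)
      ≡⟨ ∑F-≐ i (λ u → W u j) ⟩
    W i j ∎
    where
    open ≡-Reasoning
    lem : ∀ w p q → w * (p * q) ≡ p * (q * w)
    lem = solve-∀

  weight-δ : ∀ (i j : Fin n) (W : Fin n → Fin n → ℕ) (k : ℕ) (f : Fin n → Fin n → ℕ) →
    ∑F (λ u → ∑F (λ v → W u v * (f u v + k * δ i j u v))) ≡
    ∑F (λ u → ∑F (λ v → W u v * f u v)) + k * (W i j + W j i)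
  weight-δ {n} i j W k f = begin
    ∑F (λ u → ∑F (λ v → W u v * (f u v + k * δ i j u v)))
      ≡⟨ ∑-cong (allFin n) (λ u → ∑-cong (allFin n) (λ v → lem (W u v) (f u v) k _ _)) ⟩
    ∑F (λ u → ∑F (λ v → W u v * f u v + (k * (W u v * ([ i ≐ u ] * [ j ≐ v ])) + k * (W u v * ([ j ≐ u ] * [ i ≐ v ])))))
      ≡⟨ trans (∑²-+ {n} (λ u v → W u v * f u v) _) (cong (∑F (λ u → ∑F (λ v → W u v * f u v)) +_)
          (trans (∑²-+ {n} (λ u v → k * (W u v * ([ i ≐ u ] * [ j ≐ v ]))) _) (cong₂ _+_ (pull i j) (pull j i)))) ⟩
    ∑F (λ u → ∑F (λ v → W u v * f u v)) + (k * W i j + k * W j i)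
      ≡⟨ cong (∑F (λ u → ∑F (λ v → W u v * f u v)) +_) (*-distribˡ-+ k (W i j) (W j i)) ⟨
    ∑F (λ u → ∑F (λ v → W u v * f u v)) + k * (W i j + W j i) ∎
    where
    open ≡-Reasoning
    lem : ∀ w f k p q → w * (f + k * (p + q)) ≡ w * f + (k * (w * p) + k * (w * q))
    lem = solve-∀
    pull : ∀ i j → ∑F (λ u → ∑F (λ v → k * (W u v * ([ i ≐ u ] * [ j ≐ v ])))) ≡ k * W i j
    pull i j = trans (∑-cong (allFin n) (λ u → ∑-*ˡ (allFin n) k _))
      (trans (∑-*ˡ (allFin n) k _) (cong (k *_) (∑F∑F-≐ i j W)))

weight-flipEdge : ∀ {i j : Fin n} {M} W → i ≢ j → Symmetric M →
  weight W (flipEdge i j M) + ⟦ adj M i j ⟧ * (W i j + W j i) ≡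
  weight W M + ⟦ not (adj M i j) ⟧ * (W i j + W j i)
weight-flipEdge {n} {i} {j} {M} W i≢j s = begin
  weight W (flipEdge i j M) + ⟦ adj M i j ⟧ * (W i j + W j i)
    ≡⟨ weight-δ i j W ⟦ adj M i j ⟧ _ ⟨
  ∑F (λ u → ∑F (λ v → W u v * (⟦ adj (flipEdge i j M) u v ⟧ + ⟦ adj M i j ⟧ * δ i j u v)))
    ≡⟨ ∑-cong (allFin n) (λ u → ∑-cong (allFin n) (λ v → cong (W u v *_) (flipEdge-⟦⟧ {M = M} i≢j s u v))) ⟩
  ∑F (λ u → ∑F (λ v → W u v * (⟦ adj M u v ⟧ + ⟦ not (adj M i j) ⟧ * δ i j u v)))
    ≡⟨ weight-δ i j W ⟦ not (adj M i j) ⟧ _ ⟩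
  weight W M + ⟦ not (adj M i j) ⟧ * (W i j + W j i) ∎
  where open ≡-Reasoning

weight-remove : ∀ {i j : Fin n} {M} W → i ≢ j → Symmetric M → adj M i j ≡ true →
  weight W (flipEdge i j M) + (W i j + W j i) ≡ weight W M
weight-remove {i = i} {j} {M} W i≢j s e with weight-flipEdge {M = M} W i≢j s
... | h rewrite e | +-identityʳ (W i j + W j i) = trans h (+-identityʳ _)

weight-add : ∀ {i j : Fin n} {M} W → i ≢ j → Symmetric M → adj M i j ≡ false →
  weight W (flipEdge i j M) ≡ weight W M + (W i j + W j i)
weight-add {i = i} {j} {M} W i≢j s e with weight-flipEdge {M = M} W i≢j s
... | h rewrite e | +-identityʳ (W i j + W j i) = trans (sym (+-identityʳ _)) h

-- Four toggles, defined for every quadruple and hence always a bijection. Under `Switchable` they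
-- delete ab and xy and insert ax and by.
switch : (a b x y : Fin n) → Adj n → Adj n
switch a b x y = flipEdge b y ∘ flipEdge a x ∘ flipEdge x y ∘ flipEdge a b

∑-switch : ∀ (a b x y : Fin n) (f : Adj n → ℕ) →
  ∑ (allAdj n) (f ∘ switch a b x y) ≡ ∑ (allAdj n) f
∑-switch a b x y f = begin
  _ ≡⟨ ∑-flipEdge a b (f ∘ flipEdge b y ∘ flipEdge a x ∘ flipEdge x y) ⟩
  _ ≡⟨ ∑-flipEdge x y (f ∘ flipEdge b y ∘ flipEdge a x) ⟩
  _ ≡⟨ ∑-flipEdge a x (f ∘ flipEdge b y) ⟩
  _ ≡⟨ ∑-flipEdge b y f ⟩
  _ ∎
  where open ≡-Reasoning

record Switchable (M : Adj n) (a b x y : Fin n) : Set where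
  field
    symM : Symmetric M
    irr  : Irreflexive M
    a≢x  : a ≢ x
    a≢y  : a ≢ y
    b≢x  : b ≢ x
    b≢y  : b ≢ y
    ab   : adj M a b ≡ true
    xy   : adj M x y ≡ true
    ax   : adj M a x ≡ false
    by   : adj M b y ≡ false

module _ {M : Adj n} {a b x y : Fin n} (sw : Switchable M a b x y) where
  open Switchable sw

  private
    adj⇒≢ : ∀ {u v} → adj M u v ≡ true → u ≢ v
    adj⇒≢ {u} e refl = contradiction (trans (sym e) (irr u)) λ ()

    a≢b : a ≢ b
    a≢b = adj⇒≢ ab
    x≢y : x ≢ y
    x≢y = adj⇒≢ xy

    M₁ M₂ M₃ M₄ : Adj n
    M₁ = flipEdge a b M
    M₂ = flipEdge x y M₁
    M₃ = flipEdge a x M₂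
    M₄ = flipEdge b y M₃

    sym₁ : Symmetric M₁
    sym₁ = flipEdge-symmetric {M = M} a≢b symM
    sym₂ : Symmetric M₂
    sym₂ = flipEdge-symmetric {M = M₁} x≢y sym₁
    sym₃ : Symmetric M₃
    sym₃ = flipEdge-symmetric {M = M₂} a≢x sym₂

    xy₁ : adj M₁ x y ≡ true
    xy₁ = trans (flipEdge-≢ M (inj₁ (a≢x ∘ sym)) (inj₁ (b≢x ∘ sym))) xy

    ax₂ : adj M₂ a x ≡ false
    ax₂ = trans (flipEdge-≢ M₁ (inj₁ a≢x) (inj₁ a≢y))
            (trans (flipEdge-≢ M (inj₂ (b≢x ∘ sym)) (inj₁ a≢b)) ax)

    by₃ : adj M₃ b y ≡ false
    by₃ = trans (flipEdge-≢ M₂ (inj₁ (a≢b ∘ sym)) (inj₁ b≢x))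
            (trans (flipEdge-≢ M₁ (inj₁ b≢x) (inj₁ b≢y))
              (trans (flipEdge-≢ M (inj₁ (a≢b ∘ sym)) (inj₂ (a≢y ∘ sym))) by))

  switch-symmetric : Symmetric (switch a b x y M)
  switch-symmetric = flipEdge-symmetric {M = M₃} b≢y sym₃

  switch-irreflexive : Irreflexive (switch a b x y M)
  switch-irreflexive =
    flipEdge-irreflexive {M = M₃} b≢y (flipEdge-irreflexive {M = M₂} a≢x
      (flipEdge-irreflexive {M = M₁} x≢y (flipEdge-irreflexive {M = M} a≢b irr)))

  switch-ax : adj (switch a b x y M) a x ≡ true
  switch-ax = trans (flipEdge-≢ M₃ (inj₁ a≢b) (inj₁ a≢y))
                (trans (flipEdge-ij M₂ a≢x) (cong not ax₂))

  switch-by : adj (switch a b x y M) b y ≡ true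
  switch-by = trans (flipEdge-ij M₃ b≢y) (cong not by₃)

  weight-switch : ∀ W →
    weight W (switch a b x y M) + (W a b + W b a + (W x y + W y x)) ≡
    weight W M + (W a x + W x a + (W b y + W y b))
  weight-switch W = begin
    weight W M₄ + (W a b + W b a + (W x y + W y x))
      ≡⟨ cong (_+ (W a b + W b a + (W x y + W y x)))
           (trans (weight-add {M = M₃} W b≢y sym₃ by₃)
                  (cong (_+ (W b y + W y b)) (weight-add {M = M₂} W a≢x sym₂ ax₂))) ⟩
    weight W M₂ + (W a x + W x a) + (W b y + W y b) + (W a b + W b a + (W x y + W y x))
      ≡⟨ lem (weight W M₂) (W a x + W x a) (W b y + W y b) (W a b + W b a) (W x y + W y x) ⟩
    weight W M₂ + (W x y + W y x) + (W a b + W b a) + (W a x + W x a + (W b y + W y b))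
      ≡⟨ cong (_+ (W a x + W x a + (W b y + W y b)))
           (trans (cong (_+ (W a b + W b a)) (weight-remove {M = M₁} W x≢y sym₁ xy₁))
                  (weight-remove {M = M} W a≢b symM ab)) ⟩
    weight W M + (W a x + W x a + (W b y + W y b)) ∎
    where
    open ≡-Reasoning
    lem : ∀ m p q s t → m + p + q + (s + t) ≡ m + t + s + (p + q)
    lem = solve-∀

-- Regular graphs and cuts

∧-intro : ∀ {a b} → a ≡ true → b ≡ true → a ∧ b ≡ true
∧-intro refl refl = refl

⟦⟧-mono : ∀ {a b} → (a ≡ true → b ≡ true) → ⟦ a ⟧ ≤ ⟦ b ⟧
⟦⟧-mono {false} h = z≤n
⟦⟧-mono {true}  h rewrite h refl = ≤-refl

≡ᵇ-true⇒≡ : ∀ m k → (m ≡ᵇ k) ≡ true → m ≡ k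
≡ᵇ-true⇒≡ m k h = ≡ᵇ⇒≡ m k (Equivalence.from T-≡ h)

≡⇒≡ᵇ-true : ∀ {m k} → m ≡ k → (m ≡ᵇ k) ≡ true
≡⇒≡ᵇ-true {m} {k} h = Equivalence.to T-≡ (≡⇒≡ᵇ m k h)

allB⇒ : (p : Fin n → Bool) → allB p ≡ true → ∀ i → p i ≡ true
allB⇒ p h i = go (allFin _) h (∈-allFin i)
  where
  go : ∀ xs → foldr (λ i b → p i ∧ b) true xs ≡ true → i ∈ xs → p i ≡ true
  go (x ∷ xs) h (here refl) = ∧-conicalˡ _ _ h
  go (x ∷ xs) h (there i∈)  = go xs (∧-conicalʳ (p x) _ h) i∈

⇒allB : (p : Fin n → Bool) → (∀ i → p i ≡ true) → allB p ≡ true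
⇒allB p h = go (allFin _)
  where
  go : ∀ xs → foldr (λ i b → p i ∧ b) true xs ≡ true
  go []       = refl
  go (x ∷ xs) = ∧-intro (h x) (go xs)

deg : Adj n → Fin n → ℕ
deg M u = ∑F (λ v → ⟦ adj M u v ⟧)

degree≡deg : (M : Adj n) (u : Fin n) → degree M u ≡ deg M u
degree≡deg {n} M u = length-filterᵇ (adj M u) (allFin n)

record Regular (r : ℕ) (M : Adj n) : Set where
  field
    symmetric   : Symmetric M
    irreflexive : Irreflexive M
    regular     : ∀ u → deg M u ≡ r

regularᵇ : ℕ → Adj n → Bool
regularᵇ r M = isSimple M ∧ isRegular r M

not-true : ∀ {b} → not b ≡ true → b ≡ false
not-true {false} _ = refl

regularᵇ⇒ : ∀ {r} (M : Adj n) → regularᵇ r M ≡ true → Regular r M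
regularᵇ⇒ {n} {r} M h = record
  { symmetric   = eq
  ; irreflexive = λ u → not-true (∧-conicalˡ _ _ (simple u))
  ; regular     = λ u → trans (sym (degree≡deg M u)) (≡ᵇ-true⇒≡ _ r (allB⇒ _ (∧-conicalʳ (isSimple M) _ h) u))
  }
  where
  simple = allB⇒ _ (∧-conicalˡ (isSimple M) _ h)
  eq : Symmetric M
  eq u v with adj M u v | adj M v u | allB⇒ _ (∧-conicalʳ (not (adj M u u)) _ (simple u)) v
  ... | true  | true  | _ = refl
  ... | false | false | _ = refl

allB-false : (p : Fin n → Bool) → allB p ≡ false → ∃ λ i → p i ≡ false
allB-false p h = go (allFin _) h
  where
  go : ∀ xs → foldr (λ i b → p i ∧ b) true xs ≡ false → ∃ λ i → p i ≡ false
  go (x ∷ xs) h with p x in e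
  ... | true  = go xs h
  ... | false = x , e

-- The Boolean equality inside isSimple is local to its definition and cannot be named; the
-- type of a hypothesis refuting isSimple exposes it.
isSimple-true : (M : Adj n) → Symmetric M → Irreflexive M → isSimple M ≡ true
isSimple-true M s irr with isSimple M in e
... | true  = refl
... | false with allB-false _ e
...   | u , h rewrite irr u with allB-false _ h
...     | v , h′ with adj M u v | adj M v u | s u v | h′
...       | true  | _ | refl | ()
...       | false | _ | refl | ()

⇒regularᵇ : ∀ {r} (M : Adj n) → Regular r M → regularᵇ r M ≡ true
⇒regularᵇ M R = ∧-intro (isSimple-true M symmetric irreflexive)
  (⇒allB _ (λ u → ≡⇒≡ᵇ-true (trans (degree≡deg M u) (regular u))))
  where open Regular R

countRegular≡∑ : ∀ r n → countRegular r n ≡ ∑ (allAdj n) (λ M → ⟦ regularᵇ r M ⟧)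
countRegular≡∑ r n = length-filterᵇ (regularᵇ r) (allAdj n)

-- Edges between vertex sets

joins : (P Q : Fin n → Bool) → Adj n → Fin n → Fin n → Bool
joins P Q M u v = P u ∧ Q v ∧ adj M u v

-- Ordered pairs are counted: an edge inside `S` contributes twice to `edges S S M`, while an edge
-- leaving `S` contributes once to `cross S M`.
edges : (P Q : Fin n → Bool) → Adj n → ℕ
edges P Q M = ∑² (λ u v → ⟦ joins P Q M u v ⟧)

∁ : (Fin n → Bool) → Fin n → Bool
∁ S = not ∘ S

cross : (Fin n → Bool) → Adj n → ℕ
cross S = edges S (∁ S)

card : (Fin n → Bool) → ℕ
card S = ∑F (⟦_⟧ ∘ S)

edges≡weight : ∀ P Q (M : Adj n) → edges P Q M ≡ weight (λ u v → ⟦ P u ⟧ * ⟦ Q v ⟧) M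
edges≡weight {n} P Q M = ∑²-cong {n} (λ u v → trans (⟦∧⟧ (P u) _) (trans (cong (⟦ P u ⟧ *_) (⟦∧⟧ (Q v) _)) (sym (*-assoc ⟦ P u ⟧ ⟦ Q v ⟧ _))))

edges-swap : ∀ {P Q} {M : Adj n} → Symmetric M → edges P Q M ≡ edges Q P M
edges-swap {n} {P} {Q} {M} s = trans (∑²-swap {n} _) (∑²-cong {n} (λ u v →
  trans (cong (λ e → ⟦ P v ∧ Q u ∧ e ⟧) (s v u)) (lem (P v) (Q u) _)))
  where
  lem : ∀ p q e → ⟦ p ∧ q ∧ e ⟧ ≡ ⟦ q ∧ p ∧ e ⟧
  lem true  true  e = refl
  lem true  false e = refl
  lem false true  e = refl
  lem false false e = refl

edges-split : ∀ {r} P Q {M : Adj n} → Regular r M → edges P Q M + edges P (∁ Q) M ≡ r * card P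
edges-split {n} {r} P Q {M} R = begin
  edges P Q M + edges P (∁ Q) M
    ≡⟨ ∑²-+ {n} _ _ ⟨
  ∑² (λ u v → ⟦ joins P Q M u v ⟧ + ⟦ joins P (∁ Q) M u v ⟧)
    ≡⟨ ∑²-cong {n} (λ u v → lem (P u) (Q v) (adj M u v)) ⟩
  ∑² (λ u v → ⟦ P u ⟧ * ⟦ adj M u v ⟧)
    ≡⟨ ∑-cong (allFin n) (λ u → trans (∑-*ˡ (allFin n) ⟦ P u ⟧ _) (trans (cong (⟦ P u ⟧ *_) (Regular.regular R u)) (*-comm ⟦ P u ⟧ r))) ⟩
  ∑F (λ u → r * ⟦ P u ⟧)
    ≡⟨ ∑-*ˡ (allFin n) r _ ⟩
  r * card P ∎
  where
  open ≡-Reasoning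
  lem : ∀ p q e → ⟦ p ∧ q ∧ e ⟧ + ⟦ p ∧ not q ∧ e ⟧ ≡ ⟦ p ⟧ * ⟦ e ⟧
  lem false q     e = refl
  lem true  true  e = refl
  lem true  false e = sym (+-identityʳ ⟦ e ⟧)

-- Double counting of switchings across a cut

module Switching (S : Fin n → Bool) where

  switchableᵇ : Adj n → (a b x y : Fin n) → Bool
  switchableᵇ M a b x y = joins S S M a b ∧ joins (∁ S) (∁ S) M x y ∧ not (adj M a x) ∧ not (adj M b y)

  switched : Adj n → (a b x y : Fin n) → ℕ
  switched M a b x y = ⟦ joins S (∁ S) M a x ⟧ * ⟦ joins S (∁ S) M b y ⟧

  -- After a switch, `(a , x)` and `(b , y)` range independently over the crossing edges.
  ∑⁴-switched : ∀ M → ∑⁴ (switched M) ≡ cross S M * cross S M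
  ∑⁴-switched M = begin
    ∑⁴ (switched M)
      ≡⟨ ∑-cong (allFin n) (λ a → ∑-swap (allFin n) (allFin n) _) ⟩
    ∑⁴ (λ a x b y → switched M a b x y)
      ≡⟨ ∑²-* {n} (λ a x → ⟦ joins S (∁ S) M a x ⟧) (λ b y → ⟦ joins S (∁ S) M b y ⟧) ⟨
    cross S M * cross S M ∎
    where open ≡-Reasoning

  module _ {r} {M : Adj n} (R : Regular r M) where
    open Regular R

    private
      h : Fin n → Fin n → ℕ
      h a x = ⟦ joins S (∁ S) M a x ⟧
      p : Fin n → Fin n → ℕ
      p u v = ⟦ adj M u v ⟧

      spoiled : ∑⁴ (λ a b x y → h a x * (p a b * p x y)) ≡ cross S M * (r * r)
      spoiled = begin
        ∑⁴ (λ a b x y → h a x * (p a b * p x y))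
          ≡⟨ ∑-cong (allFin n) (λ a → ∑-swap (allFin n) (allFin n) _) ⟩
        ∑² (λ a x → ∑² (λ b y → h a x * (p a b * p x y)))
          ≡⟨ ∑²-cong {n} (λ a x → trans (∑²-*ˡ {n} (h a x) _) (cong (h a x *_)
               (trans (sym (∑F-* {n} (p a) (p x))) (cong₂ _*_ (regular a) (regular x))))) ⟩
        ∑² (λ a x → h a x * (r * r))
          ≡⟨ ∑²-*ʳ {n} (r * r) h ⟩
        cross S M * (r * r) ∎
        where open ≡-Reasoning

      spoiled′ : ∑⁴ (λ a b x y → h b y * (p b a * p y x)) ≡ cross S M * (r * r)
      spoiled′ = trans (trans (∑²-swap {n} _) (∑²-cong {n} (λ b a → ∑²-swap {n} (λ x y → h b y * (p b a * p y x))))) spoiled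

      pointwise : ∀ sa sb sx sy ab xy ax by →
        ⟦ sa ∧ sb ∧ ab ⟧ * ⟦ not sx ∧ not sy ∧ xy ⟧ ≤
        ⟦ (sa ∧ sb ∧ ab) ∧ (not sx ∧ not sy ∧ xy) ∧ not ax ∧ not by ⟧ +
        (⟦ sa ∧ not sx ∧ ax ⟧ * (⟦ ab ⟧ * ⟦ xy ⟧) + ⟦ sb ∧ not sy ∧ by ⟧ * (⟦ ab ⟧ * ⟦ xy ⟧))
      pointwise false sb sx sy ab xy ax by = z≤n
      pointwise true false sx sy ab xy ax by = z≤n
      pointwise true true sx sy false xy ax by = z≤n
      pointwise true true true sy true xy ax by = z≤n
      pointwise true true false true true xy ax by = z≤n
      pointwise true true false false true false ax by = z≤n
      pointwise true true false false true true true by = s≤s z≤n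
      pointwise true true false false true true false true = s≤s z≤n
      pointwise true true false false true true false false = s≤s z≤n

    -- A pair of an inner edge ab and an outer edge xy is unusable only if ax or by is already an
    -- edge. Each crossing edge spoils at most r² pairs in either role: one neighbour is chosen at
    -- each of its ends.
    switchable-many : edges S S M * edges (∁ S) (∁ S) M ≤
      ∑⁴ (λ a b x y → ⟦ switchableᵇ M a b x y ⟧) + 2 * (r * r) * cross S M
    switchable-many = begin
      edges S S M * edges (∁ S) (∁ S) M
        ≡⟨ ∑²-* {n} _ _ ⟩
      ∑⁴ (λ a b x y → ⟦ joins S S M a b ⟧ * ⟦ joins (∁ S) (∁ S) M x y ⟧)
        ≤⟨ ∑²-mono {n} (λ a b → ∑²-mono {n} (λ x y → bound a b x y)) ⟩
      ∑⁴ (λ a b x y → g a b x y + (g₁ a b x y + g₂ a b x y))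
        ≡⟨ trans (∑⁴-+ g _) (cong (∑⁴ g +_) (∑⁴-+ g₁ g₂)) ⟩
      ∑⁴ g + (∑⁴ g₁ + ∑⁴ g₂)
        ≡⟨ cong (∑⁴ g +_) (cong₂ _+_ spoiled spoiled′) ⟩
      ∑⁴ g + (cross S M * (r * r) + cross S M * (r * r))
        ≡⟨ cong (∑⁴ g +_) (lem (cross S M) (r * r)) ⟩
      ∑⁴ g + 2 * (r * r) * cross S M ∎
      where
      open ≤-Reasoning
      g g₁ g₂ : (a b x y : Fin n) → ℕ
      g a b x y = ⟦ switchableᵇ M a b x y ⟧
      g₁ a b x y = h a x * (p a b * p x y)
      -- Both edges are written reversed, so that renaming a with b and x with y turns this into
      -- `g₁`.
      g₂ a b x y = h b y * (p b a * p y x)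
      lem : ∀ c q → c * q + c * q ≡ 2 * q * c
      lem = solve-∀
      ∑⁴-+ : ∀ f g → ∑⁴ (λ a b x y → f a b x y + g a b x y) ≡ ∑⁴ {n} f + ∑⁴ g
      ∑⁴-+ f g = trans (∑²-cong {n} (λ a b → ∑²-+ {n} (f a b) (g a b))) (∑²-+ {n} _ _)
      bound : ∀ a b x y → ⟦ joins S S M a b ⟧ * ⟦ joins (∁ S) (∁ S) M x y ⟧ ≤ g a b x y + (g₁ a b x y + g₂ a b x y)
      bound a b x y rewrite symmetric b a | symmetric y x =
        pointwise (S a) (S b) (S x) (S y) (adj M a b) (adj M x y) (adj M a x) (adj M b y)

    module _ {a b x y : Fin n} (v : switchableᵇ M a b x y ≡ true) where

      private
        inside  = ∧-conicalˡ (joins S S M a b) _ v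
        v′      = ∧-conicalʳ (joins S S M a b) _ v
        outside = ∧-conicalˡ (joins (∁ S) (∁ S) M x y) _ v′
        v″      = ∧-conicalʳ (joins (∁ S) (∁ S) M x y) _ v′

        Sa : S a ≡ true
        Sa = ∧-conicalˡ (S a) _ inside
        Sb : S b ≡ true
        Sb = ∧-conicalˡ (S b) _ (∧-conicalʳ (S a) _ inside)
        Sx : S x ≡ false
        Sx = not-true (∧-conicalˡ (not (S x)) _ outside)
        Sy : S y ≡ false
        Sy = not-true (∧-conicalˡ (not (S y)) _ (∧-conicalʳ (not (S x)) _ outside))

        apart : ∀ {u v} → S u ≡ true → S v ≡ false → u ≢ v
        apart su sv refl = contradiction (trans (sym su) sv) λ ()

        sw : Switchable M a b x y
        sw = record
          { symM = symmetric ; irr = irreflexive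
          ; a≢x = apart Sa Sx ; a≢y = apart Sa Sy ; b≢x = apart Sb Sx ; b≢y = apart Sb Sy
          ; ab = ∧-conicalʳ (S b) _ (∧-conicalʳ (S a) _ inside)
          ; xy = ∧-conicalʳ (not (S y)) _ (∧-conicalʳ (not (S x)) _ outside)
          ; ax = not-true (∧-conicalˡ (not (adj M a x)) _ v″)
          ; by = not-true (∧-conicalʳ (not (adj M a x)) _ v″)
          }

      switch-regular : Regular r (switch a b x y M)
      switch-regular = record
        { symmetric   = switch-symmetric sw
        ; irreflexive = switch-irreflexive sw
        ; regular     = λ u → trans (+-cancelʳ-≡ _ (deg (switch a b x y M) u) (deg M u) (deg-eq u)) (regular u)
        }
        where
        deg≡weight : ∀ M u → deg M u ≡ weight (λ i _ → [ u ≐ i ]) M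
        deg≡weight M u = sym (trans (∑-cong (allFin n) (λ i → ∑-*ˡ (allFin n) [ u ≐ i ] (λ j → ⟦ adj M i j ⟧))) (∑F-≐ u (deg M)))
        deg-eq : ∀ u → deg (switch a b x y M) u + ([ u ≐ a ] + [ u ≐ b ] + ([ u ≐ x ] + [ u ≐ y ])) ≡
                       deg M u + ([ u ≐ a ] + [ u ≐ b ] + ([ u ≐ x ] + [ u ≐ y ]))
        deg-eq u = begin
          deg (switch a b x y M) u + ([ u ≐ a ] + [ u ≐ b ] + ([ u ≐ x ] + [ u ≐ y ]))
            ≡⟨ cong (_+ ([ u ≐ a ] + [ u ≐ b ] + ([ u ≐ x ] + [ u ≐ y ]))) (deg≡weight (switch a b x y M) u) ⟩
          weight W (switch a b x y M) + ([ u ≐ a ] + [ u ≐ b ] + ([ u ≐ x ] + [ u ≐ y ]))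
            ≡⟨ weight-switch sw W ⟩
          weight W M + ([ u ≐ a ] + [ u ≐ x ] + ([ u ≐ b ] + [ u ≐ y ]))
            ≡⟨ cong₂ _+_ (sym (deg≡weight M u)) (lem [ u ≐ a ] [ u ≐ x ] [ u ≐ b ] [ u ≐ y ]) ⟩
          deg M u + ([ u ≐ a ] + [ u ≐ b ] + ([ u ≐ x ] + [ u ≐ y ])) ∎
          where
          open ≡-Reasoning
          W : Fin n → Fin n → ℕ
          W i _ = [ u ≐ i ]
          lem : ∀ p q s t → p + q + (s + t) ≡ p + s + (q + t)
          lem = solve-∀

      switch-cross : cross S (switch a b x y M) ≡ 2 + cross S M
      switch-cross = begin
        cross S (switch a b x y M)
          ≡⟨ edges≡weight S (∁ S) (switch a b x y M) ⟩
        weight W (switch a b x y M)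
          ≡⟨ +-identityʳ _ ⟨
        weight W (switch a b x y M) + 0
          ≡⟨ cong (weight W (switch a b x y M) +_) removed ⟨
        weight W (switch a b x y M) + (W a b + W b a + (W x y + W y x))
          ≡⟨ weight-switch sw W ⟩
        weight W M + (W a x + W x a + (W b y + W y b))
          ≡⟨ cong₂ _+_ (sym (edges≡weight S (∁ S) M)) added ⟩
        cross S M + 2
          ≡⟨ +-comm (cross S M) 2 ⟩
        2 + cross S M ∎
        where
        open ≡-Reasoning
        W : Fin n → Fin n → ℕ
        W u v = ⟦ S u ⟧ * ⟦ not (S v) ⟧
        removed : W a b + W b a + (W x y + W y x) ≡ 0
        removed rewrite Sa | Sb | Sx | Sy = refl
        added : W a x + W x a + (W b y + W y b) ≡ 2
        added rewrite Sa | Sb | Sx | Sy = refl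

      switch-switched : 1 ≤ switched (switch a b x y M) a b x y
      switch-switched rewrite Sa | Sb | Sx | Sy | switch-ax sw | switch-by sw = ≤-refl

  regularWithCut : ℕ → ℕ → Adj n → Bool
  regularWithCut r c M = regularᵇ r M ∧ (cross S M ≡ᵇ c)

  countCut : ℕ → ℕ → ℕ
  countCut r c = ∑ (allAdj n) (λ M → ⟦ regularWithCut r c M ⟧)

  -- Pairs of a graph and a switchable quadruple are counted twice. `i` and `o` are twice the
  -- numbers of edges inside and outside `S`, and `K` bounds the switchable quadruples of one graph
  -- from below. For a fixed quadruple `switch` is a bijection of all matrices, so it suffices to
  -- check where it sends the switchable graphs; the result has cut size `2 + c` and carries at most
  -- `(2 + c)²` such quadruples.
  countCut-step : ∀ {r c i o K} → i + c ≡ r * card S → o + c ≡ r * card (∁ S) →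
    K + 2 * (r * r) * c ≤ i * o → countCut r c * K ≤ countCut r (2 + c) * ((2 + c) * (2 + c))
  countCut-step {r} {c} {i} {o} {K} i≡ o≡ K≤ = begin
    countCut r c * K
      ≡⟨ ∑-*ʳ (allAdj n) K _ ⟨
    ∑ (allAdj n) (λ M → ⟦ regularWithCut r c M ⟧ * K)
      ≤⟨ ∑-mono (allAdj n) many ⟩
    ∑ (allAdj n) (λ M → ⟦ regularWithCut r c M ⟧ * ∑⁴ (λ a b x y → ⟦ switchableᵇ M a b x y ⟧))
      ≡⟨ ∑-cong (allAdj n) (λ M → sym (∑⁴-*ˡ ⟦ regularWithCut r c M ⟧ _)) ⟩
    ∑ (allAdj n) (λ M → ∑⁴ (λ a b x y → ⟦ regularWithCut r c M ⟧ * ⟦ switchableᵇ M a b x y ⟧))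
      ≡⟨ ∑-∑⁴-swap {n = n} (allAdj n) _ ⟩
    ∑⁴ (λ a b x y → ∑ (allAdj n) (λ M → ⟦ regularWithCut r c M ⟧ * ⟦ switchableᵇ M a b x y ⟧))
      ≤⟨ ∑²-mono {n} (λ a b → ∑²-mono {n} (λ x y → ∑-mono (allAdj n) (image a b x y))) ⟩
    ∑⁴ (λ a b x y → ∑ (allAdj n) (F a b x y ∘ switch a b x y))
      ≡⟨ ∑²-cong {n} (λ a b → ∑²-cong {n} (λ x y → ∑-switch a b x y (F a b x y))) ⟩
    ∑⁴ (λ a b x y → ∑ (allAdj n) (F a b x y))
      ≡⟨ ∑-∑⁴-swap {n = n} (allAdj n) _ ⟨
    ∑ (allAdj n) (λ M → ∑⁴ (λ a b x y → F a b x y M))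
      ≡⟨ ∑-cong (allAdj n) total ⟩
    ∑ (allAdj n) (λ M → ⟦ regularWithCut r (2 + c) M ⟧ * ((2 + c) * (2 + c)))
      ≡⟨ ∑-*ʳ (allAdj n) ((2 + c) * (2 + c)) _ ⟩
    countCut r (2 + c) * ((2 + c) * (2 + c)) ∎
    where
    open ≤-Reasoning
    F : (a b x y : Fin n) → Adj n → ℕ
    F a b x y M = ⟦ regularWithCut r (2 + c) M ⟧ * switched M a b x y

    ∑⁴-*ˡ : ∀ k f → ∑⁴ (λ a b x y → k * f a b x y) ≡ k * ∑⁴ {n} f
    ∑⁴-*ˡ k f = trans (∑²-cong {n} (λ a b → ∑²-*ˡ {n} k (f a b))) (∑²-*ˡ {n} k _)

    many : ∀ M → ⟦ regularWithCut r c M ⟧ * K ≤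
      ⟦ regularWithCut r c M ⟧ * ∑⁴ (λ a b x y → ⟦ switchableᵇ M a b x y ⟧)
    many M with regularWithCut r c M in eq
    ... | false = z≤n
    ... | true  = *-monoʳ-≤ 1 (+-cancelʳ-≤ (2 * (r * r) * c) K _ (begin
      K + 2 * (r * r) * c
        ≤⟨ K≤ ⟩
      i * o
        ≡⟨ cong₂ _*_ i≡edges o≡edges ⟩
      edges S S M * edges (∁ S) (∁ S) M
        ≤⟨ switchable-many R ⟩
      ∑⁴ (λ a b x y → ⟦ switchableᵇ M a b x y ⟧) + 2 * (r * r) * cross S M
        ≡⟨ cong (λ z → ∑⁴ (λ a b x y → ⟦ switchableᵇ M a b x y ⟧) + 2 * (r * r) * z) c≡ ⟩
      ∑⁴ (λ a b x y → ⟦ switchableᵇ M a b x y ⟧) + 2 * (r * r) * c ∎))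
      where
      R  = regularᵇ⇒ M (∧-conicalˡ _ _ eq)
      c≡ = ≡ᵇ-true⇒≡ (cross S M) c (∧-conicalʳ (regularᵇ r M) _ eq)
      i≡edges : i ≡ edges S S M
      i≡edges = +-cancelʳ-≡ c i _ (trans i≡ (trans (sym (edges-split S S R)) (cong (edges S S M +_) c≡)))
      o≡edges : o ≡ edges (∁ S) (∁ S) M
      o≡edges = +-cancelʳ-≡ c o _ (trans o≡ (trans (sym (edges-split (∁ S) S R))
        (trans (+-comm (edges (∁ S) S M) _) (cong (edges (∁ S) (∁ S) M +_) (trans (edges-swap {P = ∁ S} {S} {M} (Regular.symmetric R)) c≡)))))

    image : ∀ a b x y M → ⟦ regularWithCut r c M ⟧ * ⟦ switchableᵇ M a b x y ⟧ ≤ F a b x y (switch a b x y M)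
    image a b x y M with regularWithCut r c M in eq | switchableᵇ M a b x y in v
    ... | false | _     = z≤n
    ... | true  | false = z≤n
    ... | true  | true  = *-mono-≤ (≤-reflexive (cong ⟦_⟧ (sym regular′))) (switch-switched R v)
      where
      R = regularᵇ⇒ M (∧-conicalˡ _ _ eq)
      regular′ : regularWithCut r (2 + c) (switch a b x y M) ≡ true
      regular′ = ∧-intro (⇒regularᵇ _ (switch-regular R v))
        (≡⇒≡ᵇ-true (trans (switch-cross R v) (cong (2 +_) (≡ᵇ-true⇒≡ (cross S M) c (∧-conicalʳ (regularᵇ r M) _ eq)))))

    total : ∀ M → ∑⁴ (λ a b x y → F a b x y M) ≡ ⟦ regularWithCut r (2 + c) M ⟧ * ((2 + c) * (2 + c))
    total M = trans (∑⁴-*ˡ ⟦ regularWithCut r (2 + c) M ⟧ (switched M)) (trans (cong (⟦ regularWithCut r (2 + c) M ⟧ *_) (∑⁴-switched M)) fix)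
      where
      fix : ⟦ regularWithCut r (2 + c) M ⟧ * (cross S M * cross S M) ≡
            ⟦ regularWithCut r (2 + c) M ⟧ * ((2 + c) * (2 + c))
      fix with regularWithCut r (2 + c) M in eq
      ... | false = refl
      ... | true  = cong (λ z → 1 * (z * z)) (≡ᵇ-true⇒≡ (cross S M) (2 + c) (∧-conicalʳ (regularᵇ r M) _ eq))

  countCut≤ : ∀ r c → countCut r c ≤ countRegular r n
  countCut≤ r c = begin
    countCut r c                              ≤⟨ ∑-mono (allAdj n) (λ M → ⟦⟧-mono (∧-conicalˡ (regularᵇ r M) _)) ⟩
    ∑ (allAdj n) (λ M → ⟦ regularᵇ r M ⟧)     ≡⟨ countRegular≡∑ r n ⟨
    countRegular r n                          ∎
    where open ≤-Reasoning

-- Few regular graphs have a given sparse cut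

-- After `j < a` switchings the doubled inner count is at least `L + 2 (a - j)`, and the doubled
-- outer count is at least both `2 (b - j)` and `e`. Their product is therefore at least
-- `4 (a - j) (b - j) + L e`, and `L e` pays for the spoiled pairs at every step.
module Chain (S : Fin n → Bool) {r d a b L e : ℕ}
  (inner-room : 2 * a + d + L ≤ r * card S)
  (outer-room : 2 * b + d ≤ r * card (∁ S))
  (outer-excess : d + 2 * a + e ≤ r * card (∁ S))
  (excess-large : 2 * (r * r) * (d + 2 * a) ≤ L * e) where
  open Switching S

  private
    N : ℕ → ℕ
    N c = countCut r (d + 2 * c)

    step : ∀ {j} → j < a →
      N j * (4 * ((a ∸ j) * (b ∸ j))) ≤ N (suc j) * (4 * ((suc j + d) * (suc j + d)))
    step {j} j<a = begin
      N j * (4 * ((a ∸ j) * (b ∸ j)))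
        ≤⟨ countCut-step {r} {c} {r * card S ∸ c} {r * card (∁ S) ∸ c} i+c o+c room ⟩
      countCut r (2 + c) * ((2 + c) * (2 + c))
        ≤⟨ *-mono-≤ (≤-reflexive (cong (countCut r) (lem₁ d j))) (≤-trans (*-mono-≤ c≤ c≤) (≤-reflexive (lem₂ (suc j + d)))) ⟩
      N (suc j) * (4 * ((suc j + d) * (suc j + d))) ∎
      where
      open ≤-Reasoning
      c = d + 2 * j
      c≤d+2a : c ≤ d + 2 * a
      c≤d+2a = +-monoʳ-≤ d (*-monoʳ-≤ 2 (<⇒≤ j<a))
      lem₁ : ∀ d j → 2 + (d + 2 * j) ≡ d + 2 * suc j
      lem₁ = solve-∀
      lem₂ : ∀ x → 2 * x * (2 * x) ≡ 4 * (x * x)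
      lem₂ = solve-∀
      -- `d` is rounded up to `2 d`, so that the square carries the same factor 4 as the other side
      -- of the step.
      c≤ : 2 + c ≤ 2 * (suc j + d)
      c≤ = ≤-trans (m≤m+n _ d) (≤-reflexive (lem d j))
        where
        lem : ∀ d j → 2 + (d + 2 * j) + d ≡ 2 * (suc j + d)
        lem = solve-∀
      c≤A : c ≤ r * card S
      c≤A = ≤-trans c≤d+2a (≤-trans (≤-reflexive (+-comm d (2 * a))) (≤-trans (m≤m+n _ L) inner-room))
      c≤B : c ≤ r * card (∁ S)
      c≤B = ≤-trans c≤d+2a (≤-trans (m≤m+n _ e) outer-excess)
      i = r * card S ∸ c
      o = r * card (∁ S) ∸ c
      i+c : i + c ≡ r * card S
      i+c = m∸n+n≡m c≤A
      o+c : o + c ≡ r * card (∁ S)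
      o+c = m∸n+n≡m c≤B
      i≥ : L + 2 * (a ∸ j) ≤ i
      i≥ = +-cancelʳ-≤ c _ i (begin
        L + 2 * (a ∸ j) + (d + 2 * j) ≡⟨ lem L (a ∸ j) d j ⟩
        2 * (a ∸ j + j) + d + L       ≡⟨ cong (λ z → 2 * z + d + L) (m∸n+n≡m (<⇒≤ j<a)) ⟩
        2 * a + d + L                 ≤⟨ inner-room ⟩
        r * card S                    ≡⟨ i+c ⟨
        i + c                         ∎)
        where
        lem : ∀ L x d j → L + 2 * x + (d + 2 * j) ≡ 2 * (x + j) + d + L
        lem = solve-∀
      o≥ : 2 * (b ∸ j) ≤ o
      o≥ with ≤-total j b
      ... | inj₂ b≤j = ≤-trans (≤-reflexive (cong (2 *_) (m≤n⇒m∸n≡0 b≤j))) z≤n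
      ... | inj₁ j≤b = +-cancelʳ-≤ c _ o (begin
        2 * (b ∸ j) + (d + 2 * j) ≡⟨ lem (b ∸ j) d j ⟩
        2 * (b ∸ j + j) + d       ≡⟨ cong (λ z → 2 * z + d) (m∸n+n≡m j≤b) ⟩
        2 * b + d                 ≤⟨ outer-room ⟩
        r * card (∁ S)            ≡⟨ o+c ⟨
        o + c                     ∎)
        where
        lem : ∀ x d j → 2 * x + (d + 2 * j) ≡ 2 * (x + j) + d
        lem = solve-∀
      e≤o : e ≤ o
      e≤o = +-cancelʳ-≤ c e o (begin
        e + c           ≤⟨ +-monoʳ-≤ e c≤d+2a ⟩
        e + (d + 2 * a) ≡⟨ +-comm e _ ⟩
        d + 2 * a + e   ≤⟨ outer-excess ⟩
        r * card (∁ S)  ≡⟨ o+c ⟨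
        o + c           ∎)
      room : 4 * ((a ∸ j) * (b ∸ j)) + 2 * (r * r) * c ≤ i * o
      room = begin
        4 * ((a ∸ j) * (b ∸ j)) + 2 * (r * r) * c
          ≤⟨ +-mono-≤ (≤-reflexive (lem (a ∸ j) (b ∸ j))) (≤-trans (*-monoʳ-≤ (2 * (r * r)) c≤d+2a) excess-large) ⟩
        2 * (a ∸ j) * (2 * (b ∸ j)) + L * e
          ≤⟨ +-mono-≤ (*-monoʳ-≤ (2 * (a ∸ j)) o≥) (*-monoʳ-≤ L e≤o) ⟩
        2 * (a ∸ j) * o + L * o
          ≡⟨ trans (+-comm (2 * (a ∸ j) * o) (L * o)) (sym (*-distribʳ-+ o L (2 * (a ∸ j)))) ⟩
        (L + 2 * (a ∸ j)) * o
          ≤⟨ *-monoˡ-≤ o i≥ ⟩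
        i * o ∎
        where
        lem : ∀ x y → 4 * (x * y) ≡ 2 * x * (2 * y)
        lem = solve-∀

  -- Multiplying `step` over j < t yields the products of (a - j)(b - j) and of (j + 1 + d)².
  -- Dividing both by t!² turns them into products of two binomials, and the factors 4 cancel.
  chain : ∀ t → t ≤ a →
    countCut r d * ((a C t) * (b C t)) ≤ N t * (((t + d) C t) * ((t + d) C t))
  chain zero _ = ≤-reflexive (cong₂ _*_ (cong (countCut r) (sym (+-identityʳ d)))
    (trans (cong₂ _*_ (nC0≡1 a) (nC0≡1 b)) (sym (cong₂ _*_ (nC0≡1 d) (nC0≡1 d)))))
  chain (suc j) j<a = *-cancelˡ-≤ (4 * (suc j * suc j)) (begin
    4 * (suc j * suc j) * (N₀ * ((a C suc j) * (b C suc j)))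
      ≡⟨ lem₁ (suc j) N₀ (a C suc j) (b C suc j) ⟩
    N₀ * ((suc j * (a C suc j)) * (suc j * (b C suc j))) * 4
      ≡⟨ cong (λ z → N₀ * z * 4) (cong₂ _*_ (C-absorb a j) (C-absorb b j)) ⟩
    N₀ * ((a C j) * (a ∸ j) * ((b C j) * (b ∸ j))) * 4
      ≡⟨ lem₂ N₀ (a C j) (a ∸ j) (b C j) (b ∸ j) ⟩
    N₀ * ((a C j) * (b C j)) * (4 * ((a ∸ j) * (b ∸ j)))
      ≤⟨ *-monoˡ-≤ (4 * ((a ∸ j) * (b ∸ j))) (chain j (<⇒≤ j<a)) ⟩
    N j * (w * w) * (4 * ((a ∸ j) * (b ∸ j)))
      ≡⟨ lem₃ (N j) (w * w) _ ⟩
    N j * (4 * ((a ∸ j) * (b ∸ j))) * (w * w)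
      ≤⟨ *-monoˡ-≤ (w * w) (step j<a) ⟩
    N (suc j) * (4 * ((suc j + d) * (suc j + d))) * (w * w)
      ≡⟨ lem₄ (N (suc j)) (suc j + d) w ⟩
    4 * (N (suc j) * (((suc j + d) * w) * ((suc j + d) * w)))
      ≡⟨ cong (λ z → 4 * (N (suc j) * (z * z))) (C-diag d j) ⟨
    4 * (N (suc j) * ((suc j * w′) * (suc j * w′)))
      ≡⟨ lem₅ (N (suc j)) (suc j) w′ ⟩
    4 * (suc j * suc j) * (N (suc j) * (w′ * w′)) ∎)
    where
    open ≤-Reasoning
    N₀ = countCut r d
    w = (j + d) C j
    w′ = (suc j + d) C suc j
    lem₁ : ∀ s m x y → 4 * (s * s) * (m * (x * y)) ≡ m * ((s * x) * (s * y)) * 4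
    lem₁ = solve-∀
    lem₂ : ∀ m x x′ y y′ → m * (x * x′ * (y * y′)) * 4 ≡ m * (x * y) * (4 * (x′ * y′))
    lem₂ = solve-∀
    lem₃ : ∀ m x y → m * x * y ≡ m * y * x
    lem₃ = solve-∀
    lem₄ : ∀ m s w → m * (4 * (s * s)) * (w * w) ≡ 4 * (m * ((s * w) * (s * w)))
    lem₄ = solve-∀
    lem₅ : ∀ m s w → 4 * (m * ((s * w) * (s * w))) ≡ 4 * (s * s) * (m * (w * w))
    lem₅ = solve-∀

  -- The exponent `suc (d + d)` collects `d` from each of the two binomials `(t + d) C t` and one
  -- from the `suc a` terms of Vandermonde's sum.
  countCut-C : countCut r d * ((a + b) C a) ≤ suc a ^ suc (d + d) * countRegular r n
  countCut-C = begin
    N₀ * ((a + b) C a)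
      ≡⟨ cong (N₀ *_) (vandermonde a b a) ⟩
    N₀ * ∑ (upTo (suc a)) (λ i → (a C i) * (b C (a ∸ i)))
      ≡⟨ ∑-*ˡ (upTo (suc a)) N₀ _ ⟨
    ∑ (upTo (suc a)) (λ i → N₀ * ((a C i) * (b C (a ∸ i))))
      ≤⟨ ∑<-mono (suc a) term ⟩
    ∑ (upTo (suc a)) (λ _ → suc a ^ (d + d) * R)
      ≡⟨ ∑<-const (suc a) _ ⟩
    suc a * (suc a ^ (d + d) * R)
      ≡⟨ *-assoc (suc a) (suc a ^ (d + d)) R ⟨
    suc a ^ suc (d + d) * R ∎
    where
    open ≤-Reasoning
    N₀ = countCut r d
    R = countRegular r n
    term : ∀ i → i < suc a → N₀ * ((a C i) * (b C (a ∸ i))) ≤ suc a ^ (d + d) * R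
    term i (s≤s i≤a) = begin
      N₀ * ((a C i) * (b C t))
        -- Reflecting `a C i` to `a C t` with t = a - i gives both binomials the same lower index,
        -- as in `chain`.
        ≡⟨ cong (λ z → N₀ * (z * (b C t))) (nCk≡nC[n∸k] i≤a) ⟩
      N₀ * ((a C t) * (b C t))
        ≤⟨ chain t (m∸n≤m a i) ⟩
      N t * (((t + d) C t) * ((t + d) C t))
        ≤⟨ *-mono-≤ (countCut≤ r (d + 2 * t)) (*-mono-≤ w≤ w≤) ⟩
      R * (suc a ^ d * suc a ^ d)
        ≡⟨ cong (R *_) (^-distribˡ-+-* (suc a) d d) ⟨
      R * suc a ^ (d + d)
        ≡⟨ *-comm R _ ⟩
      suc a ^ (d + d) * R ∎
      where
      t = a ∸ i
      w≤ : (t + d) C t ≤ suc a ^ d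
      w≤ = ≤-trans (C-≤-^ t d) (^-monoˡ-≤ d (s≤s (m∸n≤m a i)))

^-distribʳ-* : ∀ p x y → (x * y) ^ p ≡ x ^ p * y ^ p
^-distribʳ-* zero    x y = refl
^-distribʳ-* (suc p) x y = trans (cong (x * y *_) (^-distribʳ-* p x y)) (lem x y (x ^ p) (y ^ p))
  where
  lem : ∀ x y z w → x * y * (z * w) ≡ x * z * (y * w)
  lem = solve-∀

card+card∁ : (S : Fin n → Bool) → card S + card (∁ S) ≡ n
card+card∁ {n} S = begin
  card S + card (∁ S)                    ≡⟨ ∑-+ (allFin n) _ _ ⟨
  ∑F (λ u → ⟦ S u ⟧ + ⟦ not (S u) ⟧)     ≡⟨ ∑-cong (allFin n) (λ u → lem (S u)) ⟩
  ∑F {n} (λ _ → 1)                       ≡⟨ ∑F-const n 1 ⟩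
  n * 1                                  ≡⟨ *-identityʳ n ⟩
  n                                      ∎
  where
  open ≡-Reasoning
  lem : ∀ b → ⟦ b ⟧ + ⟦ not b ⟧ ≡ 1
  lem true  = refl
  lem false = refl

-- Here a = |S| + p and b = (n - |S|) + q, so that C(a + b , a) exceeds C(n , |S|) by a factor C(p + q , p).
cut-bound : ∀ (S : Fin n → Bool) {r d L e} p → let s = card S; s̄ = card (∁ S) in
  3 ≤ r → 4 * d ≤ n → s ≤ s̄ → 2 * (s + p) + d + L ≤ r * s →
  d + 2 * (s + p) + e ≤ r * s̄ → 2 * (r * r) * (d + 2 * (s + p)) ≤ L * e →
  Switching.countCut S r d * ((n C s) * n ^ p) ≤
  8 ^ p * p ! * (suc (s + p) ^ suc (d + d) * countRegular r n)
cut-bound {n} S {r} {d} {L} {e} p r≥3 4d≤n s≤s̄ h₁ h₂ h₃ = begin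
  N₀ * ((n C s) * n ^ p)
    ≤⟨ *-monoʳ-≤ N₀ (*-monoʳ-≤ (n C s) n^p≤) ⟩
  N₀ * ((n C s) * (8 ^ p * p ! * ((p + q) C p)))
    ≡⟨ lem N₀ (n C s) (8 ^ p * p !) _ ⟩
  8 ^ p * p ! * (N₀ * ((n C s) * ((p + q) C p)))
    ≤⟨ *-monoʳ-≤ (8 ^ p * p !) (*-monoʳ-≤ N₀ (C-*-≤ n s (p + q) p)) ⟩
  8 ^ p * p ! * (N₀ * ((n + (p + q)) C (s + p)))
    ≡⟨ cong (λ m → 8 ^ p * p ! * (N₀ * (m C (s + p)))) total ⟩
  8 ^ p * p ! * (N₀ * ((s + p + (s̄ + q)) C (s + p)))
    ≤⟨ *-monoʳ-≤ (8 ^ p * p !) (Chain.countCut-C S {r} {d} {s + p} {s̄ + q} {L} {e} h₁ h₀ h₂ h₃) ⟩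
  8 ^ p * p ! * (suc (s + p) ^ suc (d + d) * countRegular r n) ∎
  where
  open ≤-Reasoning
  s = card S
  s̄ = card (∁ S)
  N₀ = Switching.countCut S r d
  -- The largest `q` with `2 (s̄ + q) + d ≤ 3 s̄`, which is all the room guaranteed outside when
  -- `r = 3`.
  q = ⌊ s̄ ∸ d /2⌋
  lem : ∀ x y z w → x * (y * (z * w)) ≡ z * (x * (y * w))
  lem = solve-∀
  n≤2s̄ : n ≤ 2 * s̄
  n≤2s̄ = begin
    n       ≡⟨ card+card∁ S ⟨
    s + s̄   ≤⟨ +-monoˡ-≤ s̄ s≤s̄ ⟩
    s̄ + s̄   ≡⟨ cong (s̄ +_) (+-identityʳ s̄) ⟨
    2 * s̄   ∎
  d≤s̄ : d ≤ s̄
  d≤s̄ = *-cancelˡ-≤ 2 (≤-trans (*-monoˡ-≤ d {2} {4} (s≤s (s≤s z≤n))) (≤-trans 4d≤n n≤2s̄))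
  2q≤ : 2 * q ≤ s̄ ∸ d
  2q≤ = begin
    2 * q                             ≡⟨ cong (q +_) (+-identityʳ q) ⟩
    ⌊ s̄ ∸ d /2⌋ + ⌊ s̄ ∸ d /2⌋         ≤⟨ +-monoʳ-≤ q (⌊n/2⌋≤⌈n/2⌉ (s̄ ∸ d)) ⟩
    ⌊ s̄ ∸ d /2⌋ + ⌈ s̄ ∸ d /2⌉         ≡⟨ ⌊n/2⌋+⌈n/2⌉≡n (s̄ ∸ d) ⟩
    s̄ ∸ d                             ∎
  ≤2q+1 : s̄ ∸ d ≤ suc (2 * q)
  ≤2q+1 = begin
    s̄ ∸ d                         ≡⟨ ⌊n/2⌋+⌈n/2⌉≡n (s̄ ∸ d) ⟨
    q + ⌈ s̄ ∸ d /2⌉               ≤⟨ +-monoʳ-≤ q (⌊n/2⌋-mono (n≤1+n (suc (s̄ ∸ d)))) ⟩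
    q + suc q                     ≡⟨ trans (+-suc q q) (cong (λ z → suc (q + z)) (sym (+-identityʳ q))) ⟩
    suc (2 * q)                   ∎
  -- From s̄ ≥ n/2 and d ≤ n/4 there remains s̄ - d ≥ n/4. Halving this is the origin of the 8.
  n≤8 : n ≤ 8 * suc q
  n≤8 = +-cancelˡ-≤ n _ _ (begin
    n + n                       ≤⟨ +-mono-≤ n≤2s̄ n≤2s̄ ⟩
    2 * s̄ + 2 * s̄               ≡⟨ cong (λ z → 2 * z + 2 * z) (m∸n+n≡m d≤s̄) ⟨
    2 * (s̄ ∸ d + d) + 2 * (s̄ ∸ d + d) ≡⟨ lem₁ (s̄ ∸ d) d ⟩
    4 * d + 4 * (s̄ ∸ d)         ≤⟨ +-mono-≤ 4d≤n (*-monoʳ-≤ 4 ≤2q+1) ⟩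
    n + 4 * suc (2 * q)         ≤⟨ +-monoʳ-≤ n (≤-trans (m≤m+n (4 * suc (2 * q)) 4) (≤-reflexive (lem₂ q))) ⟩
    n + 8 * suc q               ∎)
    where
    lem₁ : ∀ x d → 2 * (x + d) + 2 * (x + d) ≡ 4 * d + 4 * x
    lem₁ = solve-∀
    lem₂ : ∀ q → 4 * suc (2 * q) + 4 ≡ 8 * suc q
    lem₂ = solve-∀
  n^p≤ : n ^ p ≤ 8 ^ p * p ! * ((p + q) C p)
  n^p≤ = begin
    n ^ p                           ≤⟨ ^-monoˡ-≤ p n≤8 ⟩
    (8 * suc q) ^ p                 ≡⟨ ^-distribʳ-* p 8 (suc q) ⟩
    8 ^ p * suc q ^ p               ≤⟨ *-monoʳ-≤ (8 ^ p) (^≤!*C p q) ⟩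
    8 ^ p * (p ! * ((p + q) C p))   ≡⟨ *-assoc (8 ^ p) (p !) _ ⟨
    8 ^ p * p ! * ((p + q) C p)     ∎
  total : n + (p + q) ≡ s + p + (s̄ + q)
  total = trans (cong (_+ (p + q)) (sym (card+card∁ S))) (lem₁ s s̄ p q)
    where
    lem₁ : ∀ s t p q → s + t + (p + q) ≡ s + p + (t + q)
    lem₁ = solve-∀
  h₀ : 2 * (s̄ + q) + d ≤ r * s̄
  h₀ = begin
    2 * (s̄ + q) + d        ≡⟨ cong (_+ d) (*-distribˡ-+ 2 s̄ q) ⟩
    2 * s̄ + 2 * q + d      ≤⟨ +-monoˡ-≤ d (+-monoʳ-≤ (2 * s̄) 2q≤) ⟩
    2 * s̄ + (s̄ ∸ d) + d    ≡⟨ +-assoc (2 * s̄) _ d ⟩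
    2 * s̄ + (s̄ ∸ d + d)    ≡⟨ cong (2 * s̄ +_) (m∸n+n≡m d≤s̄) ⟩
    2 * s̄ + s̄              ≡⟨ +-comm (2 * s̄) s̄ ⟩
    3 * s̄                  ≤⟨ *-monoˡ-≤ s̄ r≥3 ⟩
    r * s̄                  ∎

-- The diagonal pairs of `S` are never edges, which saves `card S` of the `card S * card S` ordered
-- pairs.
edges-within : ∀ (S : Fin n → Bool) {M : Adj n} → Irreflexive M → edges S S M + card S ≤ card S * card S
edges-within {n} S {M} irr = begin
  edges S S M + card S
    ≡⟨ cong (edges S S M +_) (∑-cong (allFin n) (λ u → sym (∑F-≐ u (⟦_⟧ ∘ S)))) ⟩
  edges S S M + ∑² (λ u v → [ u ≐ v ] * ⟦ S v ⟧)
    ≡⟨ ∑²-+ {n} _ _ ⟨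
  ∑² (λ u v → ⟦ joins S S M u v ⟧ + [ u ≐ v ] * ⟦ S v ⟧)
    ≤⟨ ∑²-mono {n} bound ⟩
  ∑² (λ u v → ⟦ S u ⟧ * ⟦ S v ⟧)
    ≡⟨ ∑F-* {n} (⟦_⟧ ∘ S) (⟦_⟧ ∘ S) ⟨
  card S * card S ∎
  where
  open ≤-Reasoning
  lem : ∀ s t e → ⟦ s ∧ t ∧ e ⟧ + 0 ≤ ⟦ s ⟧ * ⟦ t ⟧
  lem false t     e     = z≤n
  lem true  false e     = z≤n
  lem true  true  true  = ≤-refl
  lem true  true  false = z≤n
  bound : ∀ u v → ⟦ joins S S M u v ⟧ + [ u ≐ v ] * ⟦ S v ⟧ ≤ ⟦ S u ⟧ * ⟦ S v ⟧
  bound u v with u ≟ᶠ v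
  ... | no _     = lem (S u) (S v) (adj M u v)
  ... | yes refl rewrite irr u with S u
  ...   | true  = ≤-refl
  ...   | false = z≤n

cross≥ : ∀ (S : Fin n → Bool) {r} {M : Adj n} → Regular r M → r * card S + card S ≤ card S * card S + cross S M
cross≥ S {r} {M} R = begin
  r * card S + card S                 ≡⟨ cong (_+ card S) (edges-split S S R) ⟨
  edges S S M + cross S M + card S    ≡⟨ lem (edges S S M) (cross S M) (card S) ⟩
  edges S S M + card S + cross S M    ≤⟨ +-monoˡ-≤ (cross S M) (edges-within S {M} (Regular.irreflexive R)) ⟩
  card S * card S + cross S M         ∎
  where
  open ≤-Reasoning
  lem : ∀ x y z → x + y + z ≡ x + z + y
  lem = solve-∀

-- By the counting in `cross≥`, a set of s vertices sends out at least s (r + 1 - s) edges. For s =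
-- 1, 2, 3 this exceeds r/2 as soon as r ≥ 3.
sparse-cut⇒4≤ : ∀ {r s d} → 3 ≤ r → 2 * d ≤ r → 1 ≤ s → r * s + s ≤ s * s + d → 4 ≤ s
sparse-cut⇒4≤ {r} {suc zero} {d} r≥3 2d≤r _ h = contradiction (≤-trans (*-monoʳ-≤ 2 r≤d) 2d≤r) (<⇒≱ r<2r)
  where
  r≤d : r ≤ d
  r≤d = +-cancelʳ-≤ 1 r d (≤-trans (≤-reflexive (cong (_+ 1) (sym (*-identityʳ r)))) (≤-trans h (≤-reflexive (+-comm 1 d))))
  r<2r : r < 2 * r
  r<2r = ≤-trans (+-monoˡ-≤ r (≤-trans (s≤s z≤n) r≥3)) (≤-reflexive (cong (r +_) (sym (+-identityʳ r))))
sparse-cut⇒4≤ {r} {suc (suc zero)} {d} r≥3 2d≤r _ h = contradiction bad (<⇒≱ (s≤s (s≤s (s≤s (s≤s (s≤s z≤n))))))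
  where
  open ≤-Reasoning
  bad : 9 ≤ 4
  bad = ≤-trans (*-monoʳ-≤ 3 r≥3) (+-cancelˡ-≤ (r + 4) _ _ (begin
    r + 4 + 3 * r      ≡⟨ lem r ⟩
    2 * (r * 2 + 2)    ≤⟨ *-monoʳ-≤ 2 h ⟩
    2 * (4 + d)        ≡⟨ lem′ d ⟩
    8 + 2 * d          ≤⟨ +-monoʳ-≤ 8 2d≤r ⟩
    8 + r              ≡⟨ lem″ r ⟩
    r + 4 + 4          ∎))
    where
    lem : ∀ r → r + 4 + 3 * r ≡ 2 * (r * 2 + 2)
    lem = solve-∀
    lem′ : ∀ d → 2 * (4 + d) ≡ 8 + 2 * d
    lem′ = solve-∀
    lem″ : ∀ r → 8 + r ≡ r + 4 + 4
    lem″ = solve-∀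
sparse-cut⇒4≤ {r} {suc (suc (suc zero))} {d} r≥3 2d≤r _ h =
  contradiction bad (<⇒≱ (m≤m+n 13 2))
  where
  open ≤-Reasoning
  bad : 15 ≤ 12
  bad = ≤-trans (*-monoʳ-≤ 5 r≥3) (+-cancelˡ-≤ (r + 6) _ _ (begin
    r + 6 + 5 * r      ≡⟨ lem r ⟩
    2 * (r * 3 + 3)    ≤⟨ *-monoʳ-≤ 2 h ⟩
    2 * (9 + d)        ≡⟨ lem′ d ⟩
    18 + 2 * d         ≤⟨ +-monoʳ-≤ 18 2d≤r ⟩
    18 + r             ≡⟨ lem″ r ⟩
    r + 6 + 12         ∎))
    where
    lem : ∀ r → r + 6 + 5 * r ≡ 2 * (r * 3 + 3)
    lem = solve-∀
    lem′ : ∀ d → 2 * (9 + d) ≡ 18 + 2 * d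
    lem′ = solve-∀
    lem″ : ∀ r → 18 + r ≡ r + 6 + 12
    lem″ = solve-∀
sparse-cut⇒4≤ {s = suc (suc (suc (suc s)))} _ _ _ _ = s≤s (s≤s (s≤s (s≤s z≤n)))

-- The room for gain `p = 1` and slack `L = 1`. It is tight at r = 3, s = 4, d = 1, where both sides
-- are 12.
inner-room-small : ∀ {r s d} → 3 ≤ r → 4 ≤ s → 2 * d ≤ r → 2 * (s + 1) + d + 1 ≤ r * s
inner-room-small {d = d} r≥3 s≥4 2d≤r with m≤n⇒∃[o]m+o≡n r≥3 | m≤n⇒∃[o]m+o≡n s≥4
... | m , refl | k , refl = begin
  2 * (4 + k + 1) + d + 1               ≤⟨ +-monoˡ-≤ 1 (+-monoʳ-≤ (2 * (4 + k + 1)) d≤) ⟩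
  2 * (4 + k + 1) + (1 + 4 * m) + 1     ≤⟨ m≤m+n _ (k + m * k) ⟩
  2 * (4 + k + 1) + (1 + 4 * m) + 1 + (k + m * k) ≡⟨ lem m k ⟩
  (3 + m) * (4 + k)                     ∎
  where
  open ≤-Reasoning
  lem : ∀ m k → 2 * (4 + k + 1) + (1 + 4 * m) + 1 + (k + m * k) ≡ (3 + m) * (4 + k)
  lem = solve-∀
  -- With r = 3 + m, the bound r/2 on `d` is relaxed to what the product (3 + m)(4 + k) leaves over,
  -- apart from the term k + m k.
  d≤ : d ≤ 1 + 4 * m
  d≤ = ≮⇒≥ λ d> → contradiction (begin
    4 + m            ≤⟨ m≤m+n (4 + m) (7 * m) ⟩
    4 + m + 7 * m    ≡⟨ lem′ m ⟩
    2 * (2 + 4 * m)  ≤⟨ *-monoʳ-≤ 2 d> ⟩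
    2 * d            ≤⟨ 2d≤r ⟩
    3 + m            ∎) (<-irrefl refl)
    where
    lem′ : ∀ m → 4 + m + 7 * m ≡ 2 * (2 + 4 * m)
    lem′ = solve-∀

-- Bounded sets and large sets

module CutsRare (r : ℕ) (r≥3 : 3 ≤ r) where

  -- For large sets the polynomial loss is at most n^(r + 1), and n² must survive to pay for the sum
  -- over all sizes; hence the gain `h` of r + 3 powers. `K₁` and `K₂` bound the constants of
  -- `cut-bound` for gains 1 and `h`. `N₁` ensures `4 d ≤ n` and, since s̄ ≥ n/2, an outer side of
  -- at least `s₁ (1 + 2 r²)` vertices.
  h s₁ K₁ K₂ N₁ : ℕ
  h  = r + 3
  -- From s₁ on, the slack L = s - (2 h + d) is at least s / 2 and at least 12 r².
  s₁ = (2 * h + r) + (2 * h + r) + 12 * (r * r)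
  K₁ = 8 * (2 + s₁) ^ suc r
  K₂ = 8 ^ h * h !
  N₁ = 4 * r + 2 * (s₁ * (1 + 2 * (r * r)))

  module _ {n : ℕ} (n≥ : N₁ ≤ n) (S : Fin n → Bool) {d : ℕ} (2d≤r : 2 * d ≤ r) (s≤s̄ : card S ≤ card (∁ S)) where

    private
      s = card S
      s̄ = card (∁ S)
      N₀ = Switching.countCut S r d
      R = countRegular r n

      d≤r : d ≤ r
      d≤r = ≤-trans (m≤m+n d (d + 0)) 2d≤r

      4d≤n : 4 * d ≤ n
      4d≤n = ≤-trans (*-monoʳ-≤ 4 d≤r) (≤-trans (m≤m+n (4 * r) _) n≥)

      2d<r+1 : suc (d + d) ≤ suc r
      2d<r+1 = s≤s (≤-trans (≤-reflexive (cong (d +_) (sym (+-identityʳ d)))) 2d≤r)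

    -- Inside a bounded set only the slack `L = 1` is available, but the outer side is huge, so the
    -- whole loss is charged to the outer excess `e = 2 r² c₁`.
    rare-small : 4 ≤ s → s < s₁ → N₀ * ((n C s) * n) ≤ K₁ * R
    rare-small s≥4 s<s₁ = begin
      N₀ * ((n C s) * n)
        ≡⟨ cong (λ z → N₀ * ((n C s) * z)) (*-identityʳ n) ⟨
      N₀ * ((n C s) * n ^ 1)
        ≤⟨ cut-bound S {r} {d} {1} {2 * (r * r) * c₁} 1 r≥3 4d≤n s≤s̄ room excess (≤-reflexive (sym (+-identityʳ _))) ⟩
      8 * (suc (s + 1) ^ suc (d + d) * R)
        ≡⟨ *-assoc 8 (suc (s + 1) ^ suc (d + d)) R ⟨
      8 * suc (s + 1) ^ suc (d + d) * R
        ≤⟨ *-monoˡ-≤ R (*-monoʳ-≤ 8 (≤-trans (^-monoʳ-≤ (suc (s + 1)) 2d<r+1) (^-monoˡ-≤ (suc r) base))) ⟩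
      K₁ * R ∎
      where
      open ≤-Reasoning
      c₁ = d + 2 * (s + 1)
      room : 2 * (s + 1) + d + 1 ≤ r * s
      room = inner-room-small r≥3 s≥4 2d≤r
      base : suc (s + 1) ≤ 2 + s₁
      base = s≤s (≤-trans (≤-reflexive (+-comm s 1)) (s≤s (<⇒≤ s<s₁)))
      s̄-large : s₁ * (1 + 2 * (r * r)) ≤ s̄
      s̄-large = *-cancelˡ-≤ 2 (begin
        2 * (s₁ * (1 + 2 * (r * r))) ≤⟨ m≤n+m _ (4 * r) ⟩
        N₁                           ≤⟨ n≥ ⟩
        n                            ≡⟨ card+card∁ S ⟨
        s + s̄                        ≤⟨ +-monoˡ-≤ s̄ s≤s̄ ⟩
        s̄ + s̄                        ≡⟨ cong (s̄ +_) (+-identityʳ s̄) ⟨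
        2 * s̄                        ∎)
      c₁≤ : c₁ ≤ r * s₁
      c₁≤ = begin
        d + 2 * (s + 1)       ≡⟨ +-comm d _ ⟩
        2 * (s + 1) + d       ≤⟨ m≤m+n _ 1 ⟩
        2 * (s + 1) + d + 1   ≤⟨ room ⟩
        r * s                 ≤⟨ *-monoʳ-≤ r (<⇒≤ s<s₁) ⟩
        r * s₁                ∎
      excess : c₁ + 2 * (r * r) * c₁ ≤ r * s̄
      excess = begin
        c₁ + 2 * (r * r) * c₁           ≡⟨ *-comm (1 + 2 * (r * r)) c₁ ⟩
        c₁ * (1 + 2 * (r * r))          ≤⟨ *-monoˡ-≤ (1 + 2 * (r * r)) c₁≤ ⟩
        r * s₁ * (1 + 2 * (r * r))      ≡⟨ *-assoc r s₁ _ ⟩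
        r * (s₁ * (1 + 2 * (r * r)))    ≤⟨ *-monoʳ-≤ r s̄-large ⟩
        r * s̄                           ∎

    -- The outer side may be no larger than `S`, so the trade-off is reversed: the excess
    -- `e = 12 r²` is constant and the slack `L` grows with `s`. The 12 comes from d + 2 (s + h) ≤ 3
    -- s ≤ 6 L.
    rare-large : s₁ ≤ s → N₀ * ((n C s) * (n * n)) ≤ K₂ * R
    rare-large s≥s₁ = *-cancelˡ-≤ (n ^ suc r) {{m^n≢0 n (suc r) {{n≢0}}}} (begin
      n ^ suc r * (N₀ * ((n C s) * (n * n)))
        ≡⟨ lem₁ (n ^ r) n N₀ (n C s) ⟩
      N₀ * ((n C s) * (n ^ r * (n * (n * (n * 1)))))
        ≡⟨ cong (λ z → N₀ * ((n C s) * z)) (^-distribˡ-+-* n r 3) ⟨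
      N₀ * ((n C s) * n ^ h)
        ≤⟨ cut-bound S {r} {d} {L} {12 * (r * r)} h r≥3 4d≤n s≤s̄ room excess slack ⟩
      K₂ * (suc (s + h) ^ suc (d + d) * R)
        ≤⟨ *-monoʳ-≤ K₂ (*-monoˡ-≤ R (≤-trans (^-monoʳ-≤ (suc (s + h)) 2d<r+1) (^-monoˡ-≤ (suc r) base))) ⟩
      K₂ * (n ^ suc r * R)
        ≡⟨ lem₂ K₂ (n ^ suc r) R ⟩
      n ^ suc r * (K₂ * R) ∎)
      where
      open ≤-Reasoning
      lem₁ : ∀ p n m c → n * p * (m * (c * (n * n))) ≡ m * (c * (p * (n * (n * (n * 1)))))
      lem₁ = solve-∀
      lem₂ : ∀ x y z → x * (y * z) ≡ y * (x * z)
      lem₂ = solve-∀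
      ρ = 2 * h + d
      ρ≤ : ρ ≤ 2 * h + r
      ρ≤ = +-monoʳ-≤ (2 * h) d≤r
      L = s ∸ ρ
      ρ≤s : ρ ≤ s
      ρ≤s = ≤-trans ρ≤ (≤-trans (m≤m+n _ _) (≤-trans (m≤m+n _ (12 * (r * r))) s≥s₁))
      L+ρ : L + ρ ≡ s
      L+ρ = m∸n+n≡m ρ≤s
      L≥ : (2 * h + r) + 12 * (r * r) ≤ L
      L≥ = +-cancelʳ-≤ ρ _ L (begin
        (2 * h + r) + 12 * (r * r) + ρ              ≤⟨ +-monoʳ-≤ ((2 * h + r) + 12 * (r * r)) ρ≤ ⟩
        (2 * h + r) + 12 * (r * r) + (2 * h + r)    ≡⟨ lem (2 * h + r) (12 * (r * r)) ⟩
        s₁                                          ≤⟨ s≥s₁ ⟩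
        s                                           ≡⟨ L+ρ ⟨
        L + ρ                                       ∎)
        where
        lem : ∀ x y → x + y + x ≡ x + x + y
        lem = solve-∀
      room-≡ : 2 * (s + h) + d + L ≡ 3 * s
      room-≡ = begin-equality
        2 * (s + h) + d + L     ≡⟨ lem s h d L ⟩
        2 * s + (L + ρ)         ≡⟨ cong (2 * s +_) L+ρ ⟩
        2 * s + s               ≡⟨ +-comm (2 * s) s ⟩
        3 * s                   ∎
        where
        lem : ∀ s h d L → 2 * (s + h) + d + L ≡ 2 * s + (L + (2 * h + d))
        lem = solve-∀
      room : 2 * (s + h) + d + L ≤ r * s
      room = ≤-trans (≤-reflexive room-≡) (*-monoˡ-≤ s r≥3)
      excess : d + 2 * (s + h) + 12 * (r * r) ≤ r * s̄
      excess = begin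
        d + 2 * (s + h) + 12 * (r * r)   ≤⟨ +-monoʳ-≤ (d + 2 * (s + h)) (≤-trans (m≤n+m _ (2 * h + r)) L≥) ⟩
        d + 2 * (s + h) + L              ≡⟨ cong (_+ L) (+-comm d _) ⟩
        2 * (s + h) + d + L              ≤⟨ room ⟩
        r * s                            ≤⟨ *-monoʳ-≤ r s≤s̄ ⟩
        r * s̄                            ∎
      s≤2L : s ≤ 2 * L
      s≤2L = begin
        s       ≡⟨ L+ρ ⟨
        L + ρ   ≤⟨ +-monoʳ-≤ L (≤-trans ρ≤ (≤-trans (m≤m+n _ _) L≥)) ⟩
        L + L   ≡⟨ cong (L +_) (+-identityʳ L) ⟨
        2 * L   ∎
      slack : 2 * (r * r) * (d + 2 * (s + h)) ≤ L * (12 * (r * r))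
      slack = begin
        2 * (r * r) * (d + 2 * (s + h))   ≤⟨ *-monoʳ-≤ (2 * (r * r)) c₁≤ ⟩
        2 * (r * r) * (3 * (2 * L))       ≡⟨ lem (r * r) L ⟩
        L * (12 * (r * r))                ∎
        where
        lem : ∀ q L → 2 * q * (3 * (2 * L)) ≡ L * (12 * q)
        lem = solve-∀
        c₁≤ : d + 2 * (s + h) ≤ 3 * (2 * L)
        c₁≤ = begin
          d + 2 * (s + h)       ≡⟨ +-comm d _ ⟩
          2 * (s + h) + d       ≤⟨ m≤m+n _ L ⟩
          2 * (s + h) + d + L   ≡⟨ room-≡ ⟩
          3 * s                 ≤⟨ *-monoʳ-≤ 3 s≤2L ⟩
          3 * (2 * L)           ∎
      h<s : suc h ≤ s
      h<s = begin
        suc h               ≤⟨ s≤s (m≤m+n h (h + 0)) ⟩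
        1 + 2 * h           ≤⟨ +-monoˡ-≤ (2 * h) (≤-trans (s≤s z≤n) r≥3) ⟩
        r + 2 * h           ≡⟨ +-comm r _ ⟩
        2 * h + r           ≤⟨ ≤-trans (m≤m+n _ _) (m≤m+n _ _) ⟩
        s₁                  ≤⟨ s≥s₁ ⟩
        s                   ∎
      base : suc (s + h) ≤ n
      base = begin
        suc (s + h)   ≡⟨ +-suc s h ⟨
        s + suc h     ≤⟨ +-monoʳ-≤ s (≤-trans h<s s≤s̄) ⟩
        s + s̄         ≡⟨ card+card∁ S ⟩
        n             ∎
      n≢0 : NonZero n
      n≢0 = >-nonZero (≤-trans (s≤s z≤n) base)

    empty-small : s < 4 → 1 ≤ s → N₀ ≡ 0
    empty-small s<4 s≥1 = trans (∑-cong (allAdj n) none) (∑-zero (allAdj n))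
      where
      none : ∀ M → ⟦ Switching.regularWithCut S r d M ⟧ ≡ 0
      none M with Switching.regularWithCut S r d M in eq
      ... | false = refl
      ... | true = contradiction
        (sparse-cut⇒4≤ {r} {s} {d} r≥3 2d≤r s≥1
          (subst (λ z → r * s + s ≤ s * s + z) (≡ᵇ-true⇒≡ (cross S M) d (∧-conicalʳ (regularᵇ r M) _ eq))
            (cross≥ S (regularᵇ⇒ M (∧-conicalˡ _ _ eq)))))
        (<⇒≱ s<4)

    -- One formula for both regimes. Summed over all sizes its last factor is linear in n, one power
    -- below the n² on the left.
    rare : 1 ≤ s → N₀ * ((n C s) * (n * n)) ≤ (K₁ + K₂) * R * (⟦ s <ᵇ s₁ ⟧ * n + 1)
    rare s≥1 with s <? 4 | s <? s₁
    ... | yes s<4 | _ rewrite empty-small s<4 s≥1 = z≤n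
    ... | no s≮4 | yes s<s₁ = begin
      N₀ * ((n C s) * (n * n))      ≡⟨ lem N₀ (n C s) n ⟩
      N₀ * ((n C s) * n) * n        ≤⟨ *-monoˡ-≤ n (rare-small (≮⇒≥ s≮4) s<s₁) ⟩
      K₁ * R * n                    ≤⟨ *-mono-≤ (*-monoˡ-≤ R (m≤m+n K₁ K₂)) (≤-trans (m≤m+n n 0) (m≤m+n (1 * n) 1)) ⟩
      (K₁ + K₂) * R * (1 * n + 1)   ≡⟨ cong (λ b → (K₁ + K₂) * R * (⟦ b ⟧ * n + 1)) (Equivalence.to T-≡ (<⇒<ᵇ s<s₁)) ⟨
      (K₁ + K₂) * R * (⟦ s <ᵇ s₁ ⟧ * n + 1) ∎
      where
      open ≤-Reasoning
      lem : ∀ x y n → x * (y * (n * n)) ≡ x * (y * n) * n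
      lem = solve-∀
    ... | no _ | no s≮s₁ = begin
      N₀ * ((n C s) * (n * n))      ≤⟨ rare-large (≮⇒≥ s≮s₁) ⟩
      K₂ * R                        ≤⟨ *-monoˡ-≤ R (m≤n+m K₂ K₁) ⟩
      (K₁ + K₂) * R                 ≡⟨ *-identityʳ _ ⟨
      (K₁ + K₂) * R * 1             ≤⟨ *-monoʳ-≤ ((K₁ + K₂) * R) (m≤n+m 1 (⟦ s <ᵇ s₁ ⟧ * n)) ⟩
      (K₁ + K₂) * R * (⟦ s <ᵇ s₁ ⟧ * n + 1) ∎
      where open ≤-Reasoning

-- The union bound over all cuts

subsets : ∀ n → List (Vec Bool n)
subsets n = allVecs n (true ∷ false ∷ [])

∑-subsets-suc : ∀ n (f : Vec Bool (suc n) → ℕ) →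
  ∑ (subsets (suc n)) f ≡ ∑ (subsets n) (f ∘ (true ∷_)) + ∑ (subsets n) (f ∘ (false ∷_))
∑-subsets-suc n f = trans (∑-allVecs-suc n (true ∷ false ∷ []) f) (cong (∑ (subsets n) (f ∘ (true ∷_)) +_) (+-identityʳ _))

∑-subsets-term : (f : Vec Bool n → ℕ) (v : Vec Bool n) → f v ≤ ∑ (subsets n) f
∑-subsets-term f [] = m≤m+n _ _
∑-subsets-term {suc n} f (true ∷ v) = ≤-trans (∑-subsets-term (f ∘ (true ∷_)) v) (≤-trans (m≤m+n _ _) (≤-reflexive (sym (∑-subsets-suc n f))))
∑-subsets-term {suc n} f (false ∷ v) = ≤-trans (∑-subsets-term (f ∘ (false ∷_)) v) (≤-trans (m≤n+m _ _) (≤-reflexive (sym (∑-subsets-suc n f))))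

∥_∥ : Vec Bool n → ℕ
∥ v ∥ = card (lookup v)

∥∥≤n : (v : Vec Bool n) → ∥ v ∥ ≤ n
∥∥≤n v = ≤-trans (m≤m+n ∥ v ∥ _) (≤-reflexive (card+card∁ (lookup v)))

count-subsets : ∀ n s → ∑ (subsets n) (λ v → ⟦ ∥ v ∥ ≡ᵇ s ⟧) ≡ n C s
count-subsets zero    zero    = refl
count-subsets zero    (suc s) = sym (k>n⇒nCk≡0 {0} {suc s} z<s)
count-subsets (suc n) s = trans (∑-subsets-suc n _) (trans (cong₂ _+_
  (∑-cong (subsets n) (λ v → cong (λ z → ⟦ z ≡ᵇ s ⟧) (∑F-suc (⟦_⟧ ∘ lookup (true ∷ v)))))
  (∑-cong (subsets n) (λ v → cong (λ z → ⟦ z ≡ᵇ s ⟧) (∑F-suc (⟦_⟧ ∘ lookup (false ∷ v))))))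
  (split s))
  where
  split : ∀ s → ∑ (subsets n) (λ v → ⟦ suc ∥ v ∥ ≡ᵇ s ⟧) + ∑ (subsets n) (λ v → ⟦ ∥ v ∥ ≡ᵇ s ⟧) ≡ suc n C s
  split zero = trans (cong₂ _+_ (∑-zero (subsets n)) (count-subsets n 0)) (trans (nC0≡1 n) (sym (nC0≡1 (suc n))))
  split (suc s) = trans (cong₂ _+_ (count-subsets n s) (count-subsets n (suc s))) (sym (C-pascal n s))

-- The hypothesis bounds each term of size s by `G s / C(n , s)`, and there are exactly `C(n , s)`
-- such terms. The binomial is positive for s ≤ n, so it can be cancelled instead of divided by.
∑-by-size : (f : Vec Bool n → ℕ) (G : ℕ → ℕ) → (∀ v → f v * (n C ∥ v ∥) ≤ G ∥ v ∥) →
  ∑ (subsets n) f ≤ ∑ (upTo (suc n)) G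
∑-by-size {n} f G h = begin
  ∑ (subsets n) f
    ≤⟨ ∑-mono (subsets n) (λ v → ≤-trans
         (≤-reflexive (sym (trans (cong (λ b → ⟦ b ⟧ * f v) (≡⇒≡ᵇ-true {∥ v ∥} refl)) (*-identityˡ (f v)))))
         (∑<-term (suc n) (λ s → ⟦ ∥ v ∥ ≡ᵇ s ⟧ * f v) (s≤s (∥∥≤n v)))) ⟩
  ∑ (subsets n) (λ v → ∑ (upTo (suc n)) (λ s → ⟦ ∥ v ∥ ≡ᵇ s ⟧ * f v))
    ≡⟨ ∑-swap (subsets n) (upTo (suc n)) _ ⟩
  ∑ (upTo (suc n)) (λ s → ∑ (subsets n) (λ v → ⟦ ∥ v ∥ ≡ᵇ s ⟧ * f v))
    ≤⟨ ∑<-mono (suc n) level ⟩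
  ∑ (upTo (suc n)) G ∎
  where
  open ≤-Reasoning
  level : ∀ s → s < suc n → ∑ (subsets n) (λ v → ⟦ ∥ v ∥ ≡ᵇ s ⟧ * f v) ≤ G s
  level s (s≤s s≤n) = *-cancelˡ-≤ (n C s) {{>-nonZero (C-pos s≤n)}} (begin
    (n C s) * ∑ (subsets n) (λ v → ⟦ ∥ v ∥ ≡ᵇ s ⟧ * f v)
      ≡⟨ ∑-*ˡ (subsets n) (n C s) _ ⟨
    ∑ (subsets n) (λ v → (n C s) * (⟦ ∥ v ∥ ≡ᵇ s ⟧ * f v))
      ≤⟨ ∑-mono (subsets n) bound ⟩
    ∑ (subsets n) (λ v → ⟦ ∥ v ∥ ≡ᵇ s ⟧ * G s)
      ≡⟨ trans (∑-*ʳ (subsets n) (G s) _) (cong (_* G s) (count-subsets n s)) ⟩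
    (n C s) * G s ∎)
    where
    bound : ∀ v → (n C s) * (⟦ ∥ v ∥ ≡ᵇ s ⟧ * f v) ≤ ⟦ ∥ v ∥ ≡ᵇ s ⟧ * G s
    bound v with ∥ v ∥ ≡ᵇ s in eq
    ... | false = ≤-reflexive (*-zeroʳ (n C s))
    ... | true with ≡ᵇ-true⇒≡ ∥ v ∥ s eq
    ...   | refl = ≤-trans (≤-reflexive (trans (cong ((n C s) *_) (*-identityˡ (f v))) (*-comm (n C s) (f v))))
                     (≤-trans (h v) (≤-reflexive (sym (*-identityˡ (G s)))))

∑<-<ᵇ : ∀ m k → ∑ (upTo m) (λ s → ⟦ s <ᵇ k ⟧) ≤ k
∑<-<ᵇ zero    k       = z≤n
∑<-<ᵇ (suc m) zero    = ≤-reflexive (∑-zero (upTo (suc m)))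
∑<-<ᵇ (suc m) (suc k) = ≤-trans (≤-reflexive (∑<-suc m (λ s → ⟦ s <ᵇ suc k ⟧))) (s≤s (∑<-<ᵇ m k))

-- A first-moment bound: each selected element failing `P` contributes at least 1 to the sum of `g`.
length-filterᵇ≤ : {P : X → Set} (dec : ∀ x → Dec (P x)) (p : X → Bool) (g : X → ℕ) →
  (∀ x → p x ≡ true → ¬ P x → 1 ≤ g x) → (xs : List X) →
  length (filterᵇ p xs) ≤ length (filter dec (filterᵇ p xs)) + ∑ xs (λ x → ⟦ p x ⟧ * g x)
length-filterᵇ≤ dec p g h [] = z≤n
length-filterᵇ≤ dec p g h (x ∷ xs) with p x in px
... | false = length-filterᵇ≤ dec p g h xs
... | true with dec x
...   | yes _ = s≤s (≤-trans (length-filterᵇ≤ dec p g h xs) (+-monoʳ-≤ (length (filter dec (filterᵇ p xs))) (m≤n+m _ _)))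
...   | no ¬P = ≤-trans (+-mono-≤ (≤-trans (h x px ¬P) (≤-reflexive (sym (+-identityʳ (g x))))) (length-filterᵇ≤ dec p g h xs))
                  (≤-reflexive (lem (g x + 0) (length (filter dec (filterᵇ p xs))) _))
  where
  lem : ∀ a b c → a + (b + c) ≡ b + (a + c)
  lem = solve-∀

-- Sparse cuts counted over all regular graphs

SparseCut : ℕ → Adj n → Vec Bool n → Set
SparseCut r M v = 1 ≤ ∥ v ∥ × ∥ v ∥ ≤ card (∁ (lookup v)) × 2 * cross (lookup v) M ≤ r

module _ (r : ℕ) (r≥3 : 3 ≤ r) where
  open CutsRare r r≥3

  private
    -- The conditions on a cut that do not mention the graph, separated so that they factor out when
    -- the sums over graphs and cuts are exchanged.
    eligible : Vec Bool n → ℕ → Bool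
    eligible v d = (1 ≤ᵇ ∥ v ∥) ∧ (∥ v ∥ ≤ᵇ card (∁ (lookup v))) ∧ (2 * d ≤ᵇ r)

    ≤⇒≤ᵇ-true : ∀ {a b} → a ≤ b → (a ≤ᵇ b) ≡ true
    ≤⇒≤ᵇ-true h = Equivalence.to T-≡ (≤⇒≤ᵇ h)
    ≤ᵇ-true⇒≤ : ∀ {a b} → (a ≤ᵇ b) ≡ true → a ≤ b
    ≤ᵇ-true⇒≤ h = ≤ᵇ⇒≤ _ _ (Equivalence.from T-≡ h)

    sparseCuts : Adj n → ℕ
    sparseCuts {n} M = ∑ (subsets n) λ v → ∑ (upTo (suc r)) λ d → ⟦ eligible v d ⟧ * ⟦ cross (lookup v) M ≡ᵇ d ⟧

    sparseCuts-pos : ∀ (M : Adj n) v → SparseCut r M v → 1 ≤ sparseCuts M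
    sparseCuts-pos {n} M v (ne , half , sparse) = begin
      1
        ≡⟨ cong₂ (λ b b′ → ⟦ b ⟧ * ⟦ b′ ⟧)
             (∧-intro (≤⇒≤ᵇ-true ne) (∧-intro (≤⇒≤ᵇ-true half) (≤⇒≤ᵇ-true sparse)))
             (≡⇒≡ᵇ-true {c} refl) ⟨
      ⟦ eligible v c ⟧ * ⟦ c ≡ᵇ c ⟧
        ≤⟨ ∑<-term (suc r) (λ d → ⟦ eligible v d ⟧ * ⟦ c ≡ᵇ d ⟧) (s≤s (≤-trans (m≤m+n c (c + 0)) sparse)) ⟩
      ∑ (upTo (suc r)) (λ d → ⟦ eligible v d ⟧ * ⟦ c ≡ᵇ d ⟧)
        ≤⟨ ∑-subsets-term (λ v → ∑ (upTo (suc r)) λ d → ⟦ eligible v d ⟧ * ⟦ cross (lookup v) M ≡ᵇ d ⟧) v ⟩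
      sparseCuts M ∎
      where
      open ≤-Reasoning
      c = cross (lookup v) M

    cutsTotal : ℕ → ℕ
    cutsTotal n = ∑ (subsets n) λ v → ∑ (upTo (suc r)) λ d → ⟦ eligible v d ⟧ * Switching.countCut (lookup v) r d

    ∑-sparseCuts : ∀ n → ∑ (allAdj n) (λ M → ⟦ regularᵇ r M ⟧ * sparseCuts M) ≡ cutsTotal n
    ∑-sparseCuts n = begin
      ∑ (allAdj n) (λ M → ⟦ regularᵇ r M ⟧ * sparseCuts M)
        ≡⟨ ∑-cong (allAdj n) (λ M → trans (sym (∑-*ˡ (subsets n) ⟦ regularᵇ r M ⟧ _))
             (∑-cong (subsets n) (λ v → trans (sym (∑-*ˡ (upTo (suc r)) ⟦ regularᵇ r M ⟧ _))
               (∑-cong (upTo (suc r)) (λ d → trans (lem ⟦ regularᵇ r M ⟧ ⟦ eligible v d ⟧ _)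
                 (cong (⟦ eligible v d ⟧ *_) (sym (⟦∧⟧ (regularᵇ r M) _)))))))) ⟩
      ∑ (allAdj n) (λ M → ∑ (subsets n) λ v → ∑ (upTo (suc r)) λ d → term v d M)
        ≡⟨ ∑-swap (allAdj n) (subsets n) _ ⟩
      ∑ (subsets n) (λ v → ∑ (allAdj n) λ M → ∑ (upTo (suc r)) λ d → term v d M)
        ≡⟨ ∑-cong (subsets n) (λ v → trans (∑-swap (allAdj n) (upTo (suc r)) _)
             (∑-cong (upTo (suc r)) (λ d → ∑-*ˡ (allAdj n) ⟦ eligible v d ⟧ _))) ⟩
      cutsTotal n ∎
      where
      open ≡-Reasoning
      term : Vec Bool n → ℕ → Adj n → ℕ
      term v d M = ⟦ eligible v d ⟧ * ⟦ Switching.regularWithCut (lookup v) r d M ⟧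
      lem : ∀ a b c → a * (b * c) ≡ b * (a * c)
      lem = solve-∀

    -- There are `suc r` values of the cut size. The sizes below `s₁` contribute at most `s₁ n`, and
    -- the `suc n ≤ 2 n` sizes altogether another `2 n`; hence the factor `s₁ + 2`.
    K : ℕ
    K = suc r * (K₁ + K₂) * (s₁ + 2)

    cutsTotal≤ : ∀ {n} → suc N₁ ≤ n → cutsTotal n * n ≤ K * countRegular r n
    cutsTotal≤ {n} n> = *-cancelʳ-≤ _ _ n {{>-nonZero (≤-trans (s≤s z≤n) n>)}} (begin
      cutsTotal n * n * n
        ≡⟨ *-assoc (cutsTotal n) n n ⟩
      cutsTotal n * (n * n)
        ≡⟨ ∑-*ʳ (subsets n) (n * n) _ ⟨
      ∑ (subsets n) (λ v → cuts v * (n * n))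
        ≤⟨ ∑-by-size _ G bound ⟩
      ∑ (upTo (suc n)) G
        ≡⟨ trans (∑-*ˡ (upTo (suc n)) c _) (cong (c *_) (trans (∑-+ (upTo (suc n)) (λ s → ⟦ s <ᵇ s₁ ⟧ * n) _)
             (cong₂ _+_ (∑-*ʳ (upTo (suc n)) n (λ s → ⟦ s <ᵇ s₁ ⟧)) (∑<-const (suc n) 1)))) ⟩
      c * (∑ (upTo (suc n)) (λ s → ⟦ s <ᵇ s₁ ⟧) * n + suc n * 1)
        ≤⟨ *-monoʳ-≤ c (+-mono-≤ (*-monoˡ-≤ n (∑<-<ᵇ (suc n) s₁)) (≤-trans (≤-reflexive (*-identityʳ (suc n))) (+-monoˡ-≤ n (≤-trans (s≤s z≤n) n>)))) ⟩
      c * (s₁ * n + (n + n))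
        ≡⟨ lem (suc r) (K₁ + K₂) R s₁ n ⟩
      K * R * n ∎)
      where
      open ≤-Reasoning
      R = countRegular r n
      c = suc r * ((K₁ + K₂) * R)
      G : ℕ → ℕ
      G s = c * (⟦ s <ᵇ s₁ ⟧ * n + 1)
      cuts : Vec Bool n → ℕ
      cuts v = ∑ (upTo (suc r)) λ d → ⟦ eligible v d ⟧ * Switching.countCut (lookup v) r d
      lem : ∀ a k R s n → a * (k * R) * (s * n + (n + n)) ≡ a * k * (s + 2) * R * n
      lem = solve-∀
      bound : ∀ v → cuts v * (n * n) * (n C ∥ v ∥) ≤ G ∥ v ∥
      bound v = begin
        cuts v * (n * n) * (n C ∥ v ∥)
          ≡⟨ *-assoc (cuts v) (n * n) _ ⟩
        cuts v * ((n * n) * (n C ∥ v ∥))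
          ≡⟨ ∑-*ʳ (upTo (suc r)) _ (λ d → ⟦ eligible v d ⟧ * Switching.countCut (lookup v) r d) ⟨
        ∑ (upTo (suc r)) (λ d → ⟦ eligible v d ⟧ * Switching.countCut (lookup v) r d * ((n * n) * (n C ∥ v ∥)))
          ≤⟨ ∑-mono (upTo (suc r)) each ⟩
        ∑ (upTo (suc r)) (λ _ → (K₁ + K₂) * R * g)
          ≡⟨ ∑<-const (suc r) _ ⟩
        suc r * ((K₁ + K₂) * R * g)
          ≡⟨ *-assoc (suc r) ((K₁ + K₂) * R) g ⟨
        G ∥ v ∥ ∎
        where
        g = ⟦ ∥ v ∥ <ᵇ s₁ ⟧ * n + 1
        each : ∀ d → ⟦ eligible v d ⟧ * Switching.countCut (lookup v) r d * ((n * n) * (n C ∥ v ∥)) ≤ (K₁ + K₂) * R * g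
        each d with eligible v d in eq
        ... | false = z≤n
        ... | true  = ≤-trans
          (≤-reflexive (cong₂ _*_ (*-identityˡ (Switching.countCut (lookup v) r d)) (*-comm (n * n) (n C ∥ v ∥))))
          (rare (<⇒≤ n>) (lookup v) (≤ᵇ-true⇒≤ (∧-conicalʳ (∥ v ∥ ≤ᵇ card (∁ (lookup v))) _ rest)) (≤ᵇ-true⇒≤ (∧-conicalˡ _ _ rest))
             (≤ᵇ-true⇒≤ (∧-conicalˡ _ _ eq)))
          where rest = ∧-conicalʳ (1 ≤ᵇ ∥ v ∥) _ eq

  -- A doubly negated sparse cut is enough for an exceptional graph: it only serves to refute
  -- `sparseCuts M < 1`, and the order on numbers is decidable.
  sparse-cuts-rare : {P : ∀ {n} → Adj n → Set} (dec : ∀ {n} (M : Adj n) → Dec (P M)) (N : ℕ) →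
    (∀ {n} → N ≤ n → (M : Adj n) → Regular r M → ¬ P M → ¬ ¬ ∃ (SparseCut r M)) →
    ∀ k → ∃ λ N′ → ∀ n → N′ ≤ n →
      k * (countRegular r n ∸ length (filter dec (regularGraphs r n))) ≤ countRegular r n
  sparse-cuts-rare {P} dec N exceptional k = suc N₁ + N + k * suc K , λ n n≥ →
    let open ≤-Reasoning
        R = countRegular r n
        E = R ∸ length (filter dec (regularGraphs r n))
        E≤ : E ≤ cutsTotal n
        E≤ = m≤n+o⇒m∸n≤o R _ (begin
          R ≤⟨ length-filterᵇ≤ dec (regularᵇ r) sparseCuts
                 (λ M reg ¬P → ≮⇒≥ λ none → exceptional (≤-trans (≤-trans (m≤n+m N (suc N₁)) (m≤m+n (suc N₁ + N) _)) n≥)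
                   M (regularᵇ⇒ M reg) ¬P λ (v , cut) → <⇒≱ none (sparseCuts-pos M v cut)) (allAdj n) ⟩
          length (filter dec (regularGraphs r n)) + ∑ (allAdj n) (λ M → ⟦ regularᵇ r M ⟧ * sparseCuts M)
            ≡⟨ cong (length (filter dec (regularGraphs r n)) +_) (∑-sparseCuts n) ⟩
          length (filter dec (regularGraphs r n)) + cutsTotal n ∎)
    -- Since `cutsTotal n * n ≤ K * R`, taking n ≥ k (K + 1) suffices. `suc K` is used because it is
    -- nonzero and can be cancelled.
    in *-cancelˡ-≤ (suc K) (begin
      suc K * (k * E)     ≡⟨ *-assoc (suc K) k E ⟨
      suc K * k * E       ≡⟨ cong (_* E) (*-comm (suc K) k) ⟩
      k * suc K * E       ≤⟨ *-mono-≤ (≤-trans (m≤n+m (k * suc K) (suc N₁ + N)) n≥) E≤ ⟩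
      n * cutsTotal n     ≡⟨ *-comm n (cutsTotal n) ⟩
      cutsTotal n * n     ≤⟨ cutsTotal≤ (≤-trans (≤-trans (m≤m+n (suc N₁) N) (m≤m+n _ _)) n≥) ⟩
      K * R               ≤⟨ *-monoˡ-≤ R (n≤1+n K) ⟩
      suc K * R           ∎)

-- Conflict-free connection without sparse cuts

-- Allows case distinctions on reachability wherever the goal is itself doubly negated.
em : ∀ {ℓ} {P : Set ℓ} → ¬ ¬ Dec P
em k = k (no λ p → k (yes p))

-- Double negation moves out of this universal quantifier because the index set is finite.
¬¬-∀ : {P : Fin n → Set} → (∀ i → ¬ ¬ P i) → ¬ ¬ (∀ i → P i)
¬¬-∀ {zero}  h k = k λ ()
¬¬-∀ {suc n} h k = h zero λ p₀ → ¬¬-∀ (h ∘ suc) λ ps → k λ { zero → p₀ ; (suc i) → ps i }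

-- The passage from predicates, in which reachability is phrased, to Boolean vectors, in which cuts
-- are counted.
record Represents (Q : Fin n → Set) (v : Vec Bool n) : Set where
  field
    sound    : ∀ i → lookup v i ≡ true → Q i
    complete : ∀ i → Q i → lookup v i ≡ true

  refute : ∀ i → lookup v i ≡ false → ¬ Q i
  refute i e q = contradiction (trans (sym e) (complete i q)) λ ()

  absent : ∀ i → ¬ Q i → lookup v i ≡ false
  absent i ¬q with lookup v i in e
  ... | false = refl
  ... | true  = contradiction (sound i e) ¬q

represent : (Q : Fin n → Set) → ¬ ¬ ∃ (Represents Q)
represent {n} Q k = ¬¬-∀ (λ i → em {P = Q i}) λ dec →
  k (Vec.tabulate (does ∘ dec) , record
    { sound    = λ i e → to (dec i) (trans (sym (lookup∘tabulate (does ∘ dec) i)) e)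
    ; complete = λ i q → trans (lookup∘tabulate (does ∘ dec) i) (dec-true (dec i) q) })
  where
  to : ∀ {P : Set} (d : Dec P) → does d ≡ true → P
  to (yes p) _ = p

module _ {r : ℕ} {M : Adj n} (R : Regular r M) where
  open Regular R

  ∑F-adjʳ : ∀ w → ∑F (λ u → ⟦ adj M u w ⟧) ≡ r
  ∑F-adjʳ w = trans (∑-cong (allFin n) (λ u → cong ⟦_⟧ (symmetric u w))) (regular w)

  cross-outlet : ∀ (S : Fin n → Bool) w → (∀ i j → S i ≡ true → S j ≡ false → adj M i j ≡ true → j ≡ w) →
    cross S M ≤ ∑F (λ u → ⟦ S u ⟧ * ⟦ adj M u w ⟧)
  cross-outlet S w h = ∑-mono (allFin n) λ u → ≤-trans (∑-mono (allFin n) (bound u)) (≤-reflexive (∑F-≐ w (λ v → ⟦ S u ⟧ * ⟦ adj M u v ⟧)))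
    where
    bound : ∀ u v → ⟦ joins S (∁ S) M u v ⟧ ≤ [ w ≐ v ] * (⟦ S u ⟧ * ⟦ adj M u v ⟧)
    bound u v with S u in su | S v in sv | adj M u v in uv
    ... | false | _     | _     = z≤n
    ... | true  | true  | _     = z≤n
    ... | true  | false | false = z≤n
    ... | true  | false | true  rewrite h u v su sv uv | ≐-refl w = ≤-refl

  cross-∁ : ∀ v → cross (lookup (Vec.map not v)) M ≡ cross (lookup v) M
  cross-∁ v = trans (∑²-cong {n} (λ i j → cong₂ (λ s t → ⟦ s ∧ t ∧ adj M i j ⟧) (lookup-map i not v)
                (trans (cong not (lookup-map j not v)) (not-involutive (lookup v j)))))
              (edges-swap {n} {∁ (lookup v)} {lookup v} {M} symmetric)

  card-∁ : ∀ (v : Vec Bool n) → ∥ Vec.map not v ∥ ≡ card (∁ (lookup v))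
  card-∁ v = ∑-cong (allFin n) (λ i → cong ⟦_⟧ (lookup-map i not v))

  card-∁∁ : ∀ (v : Vec Bool n) → card (∁ (lookup (Vec.map not v))) ≡ ∥ v ∥
  card-∁∁ v = ∑-cong (allFin n) (λ i → cong ⟦_⟧ (trans (cong not (lookup-map i not v)) (not-involutive (lookup v i))))

  -- Two-connectedness and linking two vertices through an edge

  module TwoConnected (r≥3 : 3 ≤ r) (n≥ : 2 + r ≤ n) (dense : ¬ ∃ (SparseCut r M)) where

    -- The set and its complement have the same crossing edges, so the smaller of the two would be a
    -- sparse cut; `i` and `j` make both nonempty.
    proper-cut : ∀ v {i j} → lookup v i ≡ true → lookup v j ≡ false → r < 2 * cross (lookup v) M
    proper-cut v {i} {j} vi vj = ≰⇒> λ sparse → case ≤-total ∥ v ∥ (card (∁ (lookup v))) of λ where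
        (inj₁ h) → dense (v , nonempty , h , sparse)
        (inj₂ h) → dense (Vec.map not v , subst (1 ≤_) (sym (card-∁ v)) cononempty ,
                   subst₂ _≤_ (sym (card-∁ v)) (sym (card-∁∁ v)) h ,
                   subst (λ c → 2 * c ≤ r) (sym (cross-∁ v)) sparse)
      where
      nonempty : 1 ≤ ∥ v ∥
      nonempty = ≤-trans (≤-reflexive (cong ⟦_⟧ (sym vi))) (∑F-term (⟦_⟧ ∘ lookup v) i)
      cononempty : 1 ≤ card (∁ (lookup v))
      cononempty = ≤-trans (≤-reflexive (cong (⟦_⟧ ∘ not) (sym vj))) (∑F-term (⟦_⟧ ∘ ∁ (lookup v)) j)

    data Reach (P : Fin n → Set) : Fin n → Fin n → Set where
      at : ∀ {u} → P u → Reach P u u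
      go   : ∀ {u w v} → P u → adj M u w ≡ true → Reach P w v → Reach P u v

    private variable
      P Q : Fin n → Set
      u v w x y : Fin n

    source : Reach P u v → P u
    source (at a)   = a
    source (go a _ _) = a

    target : Reach P u v → P v
    target (at a)   = a
    target (go _ _ p) = target p

    mapR : (∀ {i} → P i → Q i) → Reach P u v → Reach Q u v
    mapR f (at a)   = at (f a)
    mapR f (go a e p) = go (f a) e (mapR f p)

    snoc : Reach P u v → adj M v w ≡ true → P w → Reach P u w
    snoc (at a)   e b = go a e (at b)
    snoc (go a f p) e b = go a f (snoc p e b)

    reverse : Reach P u v → Reach P v u
    reverse (at a)   = at a
    reverse (go {u} {w} a e p) = snoc (reverse p) (trans (symmetric w u) e) a

    -- Every vertex of a walk reaches its end inside `P`, so the walk stays in one component.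
    selfReach : Reach P u v → Reach (λ i → Reach P i v) u v
    selfReach (at a)   = at (at a)
    selfReach (go a e p) = go (go a e p) e (selfReach p)

    -- If w separated u from v, the component of u and the rest of G - w would share the r edges at w,
    -- although each of them is a cut with more than r / 2 edges.
    no-cut-vertex : u ≢ w → v ≢ w → ¬ ¬ Reach (_≢ w) u v
    no-cut-vertex {u} {w} {v} u≢w v≢w unreachable =
      represent (Reach (_≢ w) u) λ where
        (S , repS) → represent (λ i → i ≢ w × ¬ Reach (_≢ w) u i) λ where
          (T , repT) → let
              module S = Represents repS
              module T = Represents repT
              outS : ∀ i j → lookup S i ≡ true → lookup S j ≡ false → adj M i j ≡ true → j ≡ w
              outS i j si sj e = case j ≟ᶠ w of λ where
                (yes j≡w) → j≡w
                (no j≢w)  → contradiction (snoc (S.sound i si) e j≢w) (S.refute j sj)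
              outT : ∀ i j → lookup T i ≡ true → lookup T j ≡ false → adj M i j ≡ true → j ≡ w
              outT i j ti tj e = case j ≟ᶠ w of λ where
                (yes j≡w) → j≡w
                (no j≢w)  → ⊥-elim (T.refute j tj (j≢w , λ uj →
                  proj₂ (T.sound i ti) (snoc uj (trans (symmetric j i) e) (proj₁ (T.sound i ti)))))
              at-w : Vec Bool n → Fin n → ℕ
              at-w v i = ⟦ lookup v i ⟧ * ⟦ adj M i w ⟧
              disjoint : ∀ i → at-w S i + at-w T i ≤ ⟦ adj M i w ⟧
              disjoint i = lem (lookup S i) (lookup T i) ⟦ adj M i w ⟧ (λ si ti → proj₂ (T.sound i ti) (S.sound i si))
              open ≤-Reasoning
            in <-irrefl {r + r} refl (begin-strict
              r + r
                <⟨ +-mono-< (proper-cut S (S.complete u (at u≢w)) (S.absent w (λ p → target p refl)))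
                            (proper-cut T (T.complete v (v≢w , unreachable)) (T.absent w (λ p → proj₁ p refl))) ⟩
              2 * cross (lookup S) M + 2 * cross (lookup T) M
                ≤⟨ +-mono-≤ (*-monoʳ-≤ 2 (cross-outlet (lookup S) w outS)) (*-monoʳ-≤ 2 (cross-outlet (lookup T) w outT)) ⟩
              2 * ∑F (at-w S) + 2 * ∑F (at-w T)
                ≡⟨ trans (sym (*-distribˡ-+ 2 (∑F (at-w S)) (∑F (at-w T)))) (cong (2 *_) (sym (∑-+ (allFin n) (at-w S) (at-w T)))) ⟩
              2 * ∑F (λ i → at-w S i + at-w T i)
                ≤⟨ *-monoʳ-≤ 2 (∑-mono (allFin n) disjoint) ⟩
              2 * ∑F (λ i → ⟦ adj M i w ⟧)
                ≡⟨ cong (2 *_) (∑F-adjʳ w) ⟩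
              2 * r
                ≡⟨ cong (r +_) (+-identityʳ r) ⟩
              r + r ∎)
      where
      lem : ∀ s t m → (s ≡ true → t ≡ true → ⊥) → ⟦ s ⟧ * m + ⟦ t ⟧ * m ≤ m
      lem false false m h = z≤n
      lem false true  m h = ≤-reflexive (+-identityʳ m)
      lem true  false m h = ≤-reflexive (trans (+-identityʳ (m + 0)) (+-identityʳ m))
      lem true  true  m h = ⊥-elim (h refl refl)

    -- Stands for disjoint paths from u to x and from v to y, which an edge xy joins to a single
    -- path. Only disjoint sets holding the two walks are recorded, since sets are easy to enlarge
    -- and recombine.
    Linked : (x y u v : Fin n) → Set₁
    Linked x y u v = Σ (Fin n → Set) λ A → Σ (Fin n → Set) λ B →
      (∀ {i} → A i → B i → ⊥) × Reach A u x × Reach B v y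

    -- With B the component of y and A its complement: if w does not separate u from x in A, it can be
    -- moved to B.  Otherwise let C be the component of u in A - w; then w still reaches x in A - C,
    -- and a path from u to y avoiding w leaves C directly into B.
    linked-step : u ≢ w → adj M v w ≡ true → Linked x y u v → ¬ ¬ (Linked x y u w ⊎ Linked y x u w)
    linked-step {u} {w} {v} {x} {y} u≢w vw (A₀ , B₀ , disj , ux₀ , vy₀) k = em λ where
        (yes ux′) → k (inj₁ (A-w , (λ i → B i ⊎ i ≡ w) , (λ { (a , _) (inj₁ b) → a b ; (_ , i≢w) (inj₂ i≡w) → i≢w i≡w }) ,
                      ux′ , go (inj₂ refl) (trans (symmetric w v) vw) (mapR inj₁ vy)))
        (no ¬ux′) → tail ¬ux′ ux λ where
          (inj₁ p)        → proj₂ (source p) (at (source ux , u≢w))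
          (inj₂ (inj₂ c)) → ¬ux′ c
          (inj₂ (inj₁ p)) →
            no-cut-vertex u≢w (λ y≡w → proj₁ (source p) (subst B y≡w (target vy))) λ uy →
            exit (at (source ux , u≢w)) uy λ uy′ →
            -- The roles of x and y are exchanged: u reaches y through `C` and `B`, while w reaches
            -- x in `A` without `C`.
            k (inj₂ ((λ i → C i ⊎ B i) , (λ i → A i × ¬ C i) ,
              (λ { (inj₁ c) (_ , ¬c) → ¬c c ; (inj₂ b) (a , _) → a b }) , uy′ , p))
      where
      A B A-w C : Fin n → Set
      B i = Reach B₀ i y
      A i = ¬ B i
      A-w i = A i × i ≢ w
      C = Reach A-w u
      ux : Reach A u x
      ux = mapR (λ a b → disj a (source b)) ux₀
      vy : Reach B v y
      vy = selfReach vy₀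
      -- Within `A` the component `C` can be left only through w. The walk's last departure from
      -- `C`, if there is one, therefore goes to w, and the rest of the walk avoids `C`.
      tail : ¬ Reach A-w u x → ∀ {i} → Reach A i x →
        ¬ ¬ (Reach (λ j → A j × ¬ C j) i x ⊎ Reach (λ j → A j × ¬ C j) w x ⊎ C x)
      tail ¬ux′ (at a) k = k (inj₁ (at (a , ¬ux′)))
      tail ¬ux′ (go {w = j} a e p) k = tail ¬ux′ p λ where
        (inj₂ q) → k (inj₂ q)
        (inj₁ q) → em λ where
          (no ¬c) → k (inj₁ (go (a , ¬c) e q))
          (yes c) → case j ≟ᶠ w of λ where
            (yes refl) → k (inj₂ (inj₁ q))
            (no j≢w)   → proj₂ (source q) (snoc c e (proj₁ (source q) , j≢w))
      -- A step from `C` that avoids w lands in `C` again or in `B`; once in `B`, the component of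
      -- y, the walk is completed there.
      exit : ∀ {i} → C i → Reach (_≢ w) i y → ¬ ¬ Reach (λ j → C j ⊎ B j) i y
      exit c (at _) k = k (at (inj₁ c))
      exit c (go {w = j} _ e p) k = em λ where
        (yes b) → k (go (inj₁ c) e (mapR inj₂ (selfReach b)))
        (no ¬b) → exit (snoc c e (¬b , source p)) p λ q → k (go (inj₁ c) e q)

    linked-along : Reach (_≢ u) v w → Linked x y u v → ¬ ¬ (Linked x y u w ⊎ Linked y x u w)
    linked-along (at _)   l k = k (inj₁ l)
    linked-along (go _ e p) l k = linked-step (source p ∘ sym) e l λ where
      (inj₁ l′) → linked-along p l′ k
      (inj₂ l′) → linked-along p l′ (k ∘ swap)

    -- The second endpoint starts at y itself with `B` the singleton of y, and is then moved to v
    -- along a walk avoiding u. If u is y, the same is done from x with the roles exchanged.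
    linked : x ≢ y → u ≢ v → ¬ ¬ (Linked x y u v ⊎ Linked y x u v)
    linked {x} {y} {u} {v} x≢y u≢v k with u ≟ᶠ y
    ... | no u≢y = no-cut-vertex u≢y x≢y λ ux → no-cut-vertex (u≢y ∘ sym) (u≢v ∘ sym) λ yv →
          linked-along yv ((_≢ y) , (_≡ y) , (λ i≢y i≡y → i≢y i≡y) , ux , at refl) k
    ... | yes refl = no-cut-vertex x≢y (u≢v ∘ sym) λ xv →
          linked-along xv ((_≢ x) , (_≡ x) , (λ i≢x i≡x → i≢x i≡x) , at (x≢y ∘ sym) , at refl) (k ∘ swap)

    -- Conflict-free paths and the value 2

    PathIn : (Fin n → Set) → Fin n → Fin n → Set
    PathIn P u v = ∃ λ (p : Walk M u v) → IsPath p × All P (vertices p)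

    suffix : (p : Walk M w v) → u ∈ vertices p → IsPath p → All P (vertices p) → PathIn P u v
    suffix []      (here refl) up       ap       = [] , up , ap
    suffix (e ∷ p) (here refl) up       ap       = e ∷ p , up , ap
    suffix (e ∷ p) (there u∈p) (_ ∷ up) (_ ∷ ap) = suffix p u∈p up ap

    -- Loop erasure: if the new first vertex already lies on the path, only the suffix from there is
    -- kept.
    reach⇒path : Reach P u v → PathIn P u v
    reach⇒path (at a) = [] , [] ∷ [] , a ∷ []
    reach⇒path (go {u} a e q) with reach⇒path q
    ... | p , up , ap with DecMembership._∈?_ _≟ᶠ_ u (vertices p)
    ...   | yes u∈p = suffix p u∈p up ap
    ...   | no u∉p  = Equivalence.from T-≡ e ∷ p , ¬Any⇒All¬ _ u∉p ∷ up , a ∷ ap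

    bridge : Walk M u x → T (adj M x y) → Walk M y v → Walk M u v
    bridge []       e q = e ∷ q
    bridge (e′ ∷ p) e q = e′ ∷ bridge p e q

    vertices-bridge : (p : Walk M u x) (e : T (adj M x y)) (q : Walk M y v) →
      vertices (bridge p e q) ≡ vertices p ++ vertices q
    vertices-bridge []       e q = refl
    vertices-bridge (_∷_ {u = u} _ p) e q = cong (u ∷_) (vertices-bridge p e q)

    edgeColors-bridge : ∀ {k} (c : Coloring M k) (p : Walk M u x) (e : T (adj M x y)) (q : Walk M y v) →
      edgeColors c (bridge p e q) ≡ edgeColors c p ++ col c x y ∷ edgeColors c q
    edgeColors-bridge c []       e q = refl
    edgeColors-bridge c (_∷_ {u = u} {w = w} _ p) e q = cong (col c u w ∷_) (edgeColors-bridge c p e q)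

    start : (p : Walk M u v) → All P (vertices p) → P u
    start []      (a ∷ _) = a
    start (_ ∷ p) (a ∷ _) = a

    avoids : ∀ {k} (c : Coloring M k) a → (∀ {i j} → P i → P j → a ≢ col c i j) →
      (p : Walk M u v) → All P (vertices p) → filter (a ≟ᶠ_) (edgeColors c p) ≡ []
    avoids c a h []      _        = refl
    avoids c a h (e ∷ p) (b ∷ bs) = trans (filter-reject (a ≟ᶠ_) (h b (start p bs))) (avoids c a h p bs)

    -- An edge with both ends in `A` misses y and one with both ends in `B` misses x. Hence the
    -- bridging edge is the only one of colour `a`, and disjointness of the sets makes the
    -- concatenation a path.
    linked⇒path : ∀ {k} (c : Coloring M k) {a} → adj M x y ≡ true → a ≡ col c x y →
      (∀ i j → a ≡ col c i j → (i ≡ x × j ≡ y) ⊎ (i ≡ y × j ≡ x)) →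
      Linked x y u v → ∃ λ (p : Walk M u v) → IsPath p × ConflictFree c p
    linked⇒path {x} {y} {u} {v} c {a} xy a≡ only (A , B , disj , ux , vy) =
      bridge p e q ,
      subst Unique (sym (vertices-bridge p e q)) (++⁺ up uq (λ (i∈p , i∈q) → disj (All.lookup ap i∈p) (All.lookup aq i∈q))) ,
      a , (begin
        length (filter (a ≟ᶠ_) (edgeColors c (bridge p e q)))
          ≡⟨ cong (length ∘ filter (a ≟ᶠ_)) (edgeColors-bridge c p e q) ⟩
        length (filter (a ≟ᶠ_) (edgeColors c p ++ col c x y ∷ edgeColors c q))
          ≡⟨ cong length (filter-++ (a ≟ᶠ_) (edgeColors c p) _) ⟩
        length (filter (a ≟ᶠ_) (edgeColors c p) ++ filter (a ≟ᶠ_) (col c x y ∷ edgeColors c q))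
          ≡⟨ cong₂ (λ l l′ → length (l ++ l′)) (avoids c a notA p ap)
               (trans (filter-accept (a ≟ᶠ_) a≡) (cong (col c x y ∷_) (avoids c a notB q aq))) ⟩
        1 ∎)
      where
      open ≡-Reasoning
      e = Equivalence.from T-≡ xy
      p = proj₁ (reach⇒path ux)
      up = proj₁ (proj₂ (reach⇒path ux))
      ap = proj₂ (proj₂ (reach⇒path ux))
      q = proj₁ (reach⇒path (reverse vy))
      uq = proj₁ (proj₂ (reach⇒path (reverse vy)))
      aq = proj₂ (proj₂ (reach⇒path (reverse vy)))
      notA : ∀ {i j} → A i → A j → a ≢ col c i j
      notA {i} {j} ai aj h with only i j h
      ... | inj₁ (_ , refl) = disj aj (target vy)
      ... | inj₂ (refl , _) = disj ai (target vy)
      notB : ∀ {i j} → B i → B j → a ≢ col c i j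
      notB {i} {j} bi bj h with only i j h
      ... | inj₁ (refl , _) = disj (target ux) bi
      ... | inj₂ (_ , refl) = disj (target ux) bj

    marks : (x y i j : Fin n) → Dec ((i ≡ x × j ≡ y) ⊎ (i ≡ y × j ≡ x))
    marks x y i j = (i ≟ᶠ x ×-dec j ≟ᶠ y) ⊎-dec (i ≟ᶠ y ×-dec j ≟ᶠ x)

    edgeColoring : (x y : Fin n) → Coloring M 2
    edgeColoring x y = record
      { col = λ i j → if does (marks x y i j) then zero else suc zero
      ; sym = λ i j → cong (if_then zero else suc zero) (does-⇔ (mk⇔ flip flip) (marks x y i j) (marks x y j i))
      }
      where
      flip : ∀ {i j} → (i ≡ x × j ≡ y) ⊎ (i ≡ y × j ≡ x) → (j ≡ x × i ≡ y) ⊎ (j ≡ y × i ≡ x)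
      flip (inj₁ (p , q)) = inj₂ (q , p)
      flip (inj₂ (p , q)) = inj₁ (q , p)

    marked : ∀ i j → zero ≡ col (edgeColoring x y) i j → (i ≡ x × j ≡ y) ⊎ (i ≡ y × j ≡ x)
    marked {x} {y} i j = unmark (marks x y i j)
      where
      unmark : ∀ {P : Set} (d : Dec P) → Fin.zero {1} ≡ (if does d then zero else suc zero) → P
      unmark (yes p) _ = p
      unmark (no _) ()

    mark : ∀ i j → (i ≡ x × j ≡ y) ⊎ (i ≡ y × j ≡ x) → zero ≡ col (edgeColoring x y) i j
    mark {x} {y} i j m = cong (if_then zero else suc zero) (sym (dec-true (marks x y i j) m))

    vertex : Fin n
    vertex = fromℕ< (≤-trans (s≤s z≤n) n≥)

    neighbour : ∃ λ v → adj M vertex v ≡ true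
    neighbour with any? (λ v → adj M vertex v ≟ᵇ true)
    ... | yes found = found
    ... | no none = contradiction (trans (sym (regular vertex)) (trans (∑-cong (allFin n) λ v → cong ⟦_⟧ (¬-not (λ e → none (v , e)))) (∑-zero (allFin n))))
                      (λ r≡0 → contradiction r≥3 (subst (λ r → ¬ 3 ≤ r) (sym r≡0) λ ()))

    hasCFC2 : ¬ ¬ HasCFC M 2
    hasCFC2 k with neighbour
    ... | y , xy = ¬¬-∀ (λ u → ¬¬-∀ (path u)) λ paths → k (edgeColoring vertex y , λ u v u≢v → paths u v u≢v)
      where
      x≢y : vertex ≢ y
      x≢y x≡y = contradiction (trans (sym xy) (trans (cong (adj M vertex) (sym x≡y)) (irreflexive vertex))) λ ()
      c = edgeColoring vertex y
      path : ∀ u v → ¬ ¬ (u ≢ v → ∃ λ (p : Walk M u v) → IsPath p × ConflictFree c p)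
      path u v k with u ≟ᶠ v
      ... | yes u≡v = k λ u≢v → contradiction u≡v u≢v
      ... | no u≢v = linked x≢y u≢v λ where
        (inj₁ l) → k λ _ → linked⇒path c xy (mark vertex y (inj₁ (refl , refl))) marked l
        (inj₂ l) → k λ _ → linked⇒path c (trans (symmetric y vertex) xy) (mark y vertex (inj₂ (refl , refl))) (λ i j → swap ∘ marked i j) l

    connected : HasCFC M 2 → Connected M
    connected (c , good) u v with u ≟ᶠ v
    ... | yes refl = [] , [] ∷ []
    ... | no u≢v = proj₁ (good u v u≢v) , proj₁ (proj₂ (good u v u≢v))

    length-edgeColors : (c : Coloring M 1) (p : Walk M u v) → u ≢ v → length (edgeColors c p) ≡ 1 → adj M u v ≡ true
    length-edgeColors c []          u≢v _ = contradiction refl u≢v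
    length-edgeColors c (e ∷ [])    _   _ = Equivalence.to T-≡ e
    length-edgeColors c (_ ∷ _ ∷ _) _   ()

    -- With a single colour a conflict-free path has exactly one edge, so every other vertex would
    -- be adjacent to `vertex`, whose degree r is at most n - 2.
    noCFC1 : ¬ HasCFC M 1
    noCFC1 (c , good) = <⇒≱ n≥ (begin
      n                                                   ≡⟨ trans (∑F-const n 1) (*-identityʳ n) ⟨
      ∑F {n} (λ _ → 1)                                    ≤⟨ ∑-mono (allFin n) bound ⟩
      ∑F (λ v → ⟦ adj M vertex v ⟧ + [ vertex ≐ v ] * 1)  ≡⟨ ∑-+ (allFin n) _ _ ⟩
      deg M vertex + ∑F (λ v → [ vertex ≐ v ] * 1)        ≡⟨ cong₂ _+_ (regular vertex) (∑F-≐ vertex (λ _ → 1)) ⟩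
      r + 1                                               ≡⟨ +-comm r 1 ⟩
      1 + r                                               ∎)
      where
      open ≤-Reasoning
      unique : ∀ (a b : Fin 1) → a ≡ b
      unique zero zero = refl
      adjacent : ∀ v → vertex ≢ v → adj M vertex v ≡ true
      adjacent v ≢v with good vertex v ≢v
      ... | p , _ , a , once = length-edgeColors c p ≢v
        (trans (cong length (sym (filter-all (a ≟ᶠ_) (universal (unique a) (edgeColors c p))))) once)
      bound : ∀ v → 1 ≤ ⟦ adj M vertex v ⟧ + [ vertex ≐ v ] * 1
      bound v with vertex ≟ᶠ v
      ... | yes refl = m≤n+m 1 _
      ... | no ≢v rewrite adjacent v ≢v = ≤-refl

    cfc≡2 : ¬ ¬ CFC≡2 M
    cfc≡2 k = hasCFC2 λ two → k (connected two , two , noCFC1)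

theorem1p6 : (r : ℕ) → 3 ≤ r → (dec : ∀ {n} (M : Adj n) → Dec (CFC≡2 M)) →
    (k : ℕ) → ∃ λ (N : ℕ) → ∀ (n : ℕ) → N ≤ n →
    k * (countRegular r n ∸ countCFC2 dec r n) ≤ countRegular r n
-- From `2 + r` vertices on, an r-regular graph is not complete, which rules out one colour.
theorem1p6 r r≥3 dec = sparse-cuts-rare r r≥3 dec (2 + r)
  λ n≥ M R ¬cfc dense → TwoConnected.cfc≡2 R r≥3 n≥ dense ¬cfc
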